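{- For any integer $n\geq 0$, $$\sum_{k=-n}^{n}\left[{2n \atop n+k}\right]_q (-1)^k q^{(5k-1)k/2}=\left[{2n\atop n}\right]_q\,(q;q)_n\sum_{k=0}^{n}\left[{n \atop k}\right]_q q^{k^2}.$$
   Context: $q$ is a complex number with $0<|q|<1$. For an integer $n\ge 0$, $(a;q)_n=\prod_{j=0}^{n-1}(1-aq^j)$, and the $q$-binomial coefficient is $\left[{n\atop k}\right]_q=\frac{(q;q)_n}{(q;q)_k(q;q)_{n-k}}$ for $0\le k\le n$. -}

module Defs where

open import Algebra.Bundles using (CommutativeRing; Semiring)
open import Algebra.Structures using (IsCommutativeRing)
open import Data.Empty using (⊥-elim)
open import Data.Fin.Base using (Fin; toℕ)
open import Data.Integer.Base as ℤ using (ℤ)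
open import Data.Nat.Base as ℕ using (ℕ; zero; suc)
import Data.Nat.Properties as ℕ
import Data.Nat.Coprimality as Coprimality
import Data.Integer.Properties as ℤ
open import Data.Product.Base using (∃-syntax; _×_; _,_; proj₁; proj₂)
open import Data.Rational.Base as ℚ using (ℚ; 0ℚ; 1ℚ; ½; _≤_)
  renaming (∣_∣ to abs)
import Data.Rational.Properties as ℚ
import Data.Rational.Unnormalised.Base as ℚᵘ
import Data.Rational.Unnormalised.Properties as ℚᵘ
open import Data.Rational.Solver using (module +-*-Solver)
open import Data.Sum.Base using (_⊎_; inj₁; inj₂)
open import Level using (0ℓ)
open import Relation.Binary.PropositionalEquality
  using (_≡_; refl; sym; trans; cong; cong₂; subst; subst₂)
open import Relation.Nullary.Decidable.Core using (yes; no)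

open +-*-Solver using (solve; con; _:=_; _:+_; _:*_; _:-_; :-_)

------------------------------------------------------------------------
-- Inequalities between rationals

module Rational where
  open import Data.Rational.Base using (_+_; _*_; _-_; -_; _<_)

  +-nn : ∀ {p q} → 0ℚ ≤ p → 0ℚ ≤ q → 0ℚ ≤ p + q
  +-nn {p} {q} a b = ℚ.+-mono-≤ {0ℚ} {p} {0ℚ} {q} a b

  *-nn : ∀ {p q} → 0ℚ ≤ p → 0ℚ ≤ q → 0ℚ ≤ p * q
  *-nn {p} {q} a b = ℚ.nonNegative⁻¹ (p * q)
    {{ℚ.nonNeg*nonNeg⇒nonNeg p {{ℚ.nonNegative a}} q {{ℚ.nonNegative b}}}}

  *-pos : ∀ {p q} → 0ℚ < p → 0ℚ < q → 0ℚ < p * q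
  *-pos {p} {q} a b = ℚ.positive⁻¹ (p * q)
    {{ℚ.pos*pos⇒pos p {{ℚ.positive a}} q {{ℚ.positive b}}}}

  0<1 : 0ℚ < 1ℚ
  0<1 = ℚ.positive⁻¹ 1ℚ

  0<½ : 0ℚ < ½
  0<½ = ℚ.positive⁻¹ ½

  0≤1 : 0ℚ ≤ 1ℚ
  0≤1 = ℚ.<⇒≤ 0<1

  cert : ∀ {p q} d → 0ℚ ≤ d → p + d ≡ q → p ≤ q
  cert {p} d 0≤d refl = subst (_≤ p + d) (ℚ.+-identityʳ p) (ℚ.+-monoʳ-≤ p 0≤d)

  diff : ∀ {p q} → p ≤ q → 0ℚ ≤ q - p
  diff {p} {q} h = subst (_≤ q - p) (ℚ.+-inverseʳ p) (ℚ.+-monoˡ-≤ (- p) h)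

  0<-from : ∀ {p q} → p < q → 0ℚ < q - p
  0<-from {p} {q} h = subst (_< q - p) (ℚ.+-inverseʳ p) (ℚ.+-monoˡ-< (- p) h)

  *-mono : ∀ {a b c d} → 0ℚ ≤ a → 0ℚ ≤ c → a ≤ b → c ≤ d → a * c ≤ b * d
  *-mono {a} {b} {c} {d} 0≤a 0≤c a≤b c≤d =
    cert (a * (d - c) + (b - a) * d)
      (+-nn (*-nn 0≤a (diff c≤d)) (*-nn (diff a≤b) (ℚ.≤-trans 0≤c c≤d)))
      (solve 4 (λ a b c d → a :* c :+ (a :* (d :- c) :+ (b :- a) :* d) := b :* d)
        refl a b c d)

  sq-nn : ∀ p → 0ℚ ≤ p * p
  sq-nn p with ℚ.≤-total 0ℚ p
  ... | inj₁ h = *-nn h h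
  ... | inj₂ h = subst (0ℚ ≤_) (solve 1 (λ p → (con 0ℚ :- p) :* (con 0ℚ :- p) := p :* p) refl p)
                   (*-nn (diff h) (diff h))

  p≤∣p∣ : ∀ p → p ≤ abs p
  p≤∣p∣ p with ℚ.≤-total 0ℚ p
  ... | inj₁ h = ℚ.≤-reflexive (sym (ℚ.0≤p⇒∣p∣≡p h))
  ... | inj₂ h = ℚ.≤-trans h (ℚ.0≤∣p∣ p)

  close : ∀ {a b ε} → a ≤ b + ε → b ≤ a + ε → abs (a - b) ≤ ε
  close {a} {b} {ε} h k with ℚ.∣p∣≡p∨∣p∣≡-p (a - b)
  ... | inj₁ e = subst (_≤ ε) (sym e) (cert (b + ε - a) (diff h)
                   (solve 3 (λ a b ε → a :- b :+ (b :+ ε :- a) := ε) refl a b ε))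
  ... | inj₂ e = subst (_≤ ε) (sym e) (cert (a + ε - b) (diff k)
                   (solve 3 (λ a b ε → :- (a :- b) :+ (a :+ ε :- b) := ε) refl a b ε))

  upper : ∀ {a b ε} → abs (a - b) ≤ ε → a ≤ b + ε
  upper {a} {b} {ε} h = cert (ε - (a - b)) (diff (ℚ.≤-trans (p≤∣p∣ (a - b)) h))
    (solve 3 (λ a b ε → a :+ (ε :- (a :- b)) := b :+ ε) refl a b ε)

  abs-swap : ∀ a b → abs (a - b) ≡ abs (b - a)
  abs-swap a b = trans (sym (ℚ.∣-p∣≡∣p∣ (a - b)))
    (cong abs (solve 2 (λ a b → :- (a :- b) := b :- a) refl a b))

  lower : ∀ {a b ε} → abs (a - b) ≤ ε → b ≤ a + ε
  lower {a} {b} {ε} h = upper (subst (_≤ ε) (abs-swap a b) h)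

  abs-eq : ∀ {a b ε} → a ≡ b → 0ℚ ≤ ε → abs (a - b) ≤ ε
  abs-eq {a} {ε = ε} refl h = subst (_≤ ε) (cong abs (sym (ℚ.+-inverseʳ a))) h

  half : ∀ ε → ½ * ε + ½ * ε ≡ ε
  half = solve 1 (λ ε → con ½ :* ε :+ con ½ :* ε := ε) refl

  abs-trans : ∀ {a b c δ ε} → abs (a - b) ≤ δ → abs (b - c) ≤ ε → abs (a - c) ≤ δ + ε
  abs-trans {a} {b} {c} {δ} {ε} h k =
    subst (λ t → abs t ≤ δ + ε) (solve 3 (λ a b c → a :- b :+ (b :- c) := a :- c) refl a b c)
      (ℚ.≤-trans (ℚ.∣p+q∣≤∣p∣+∣q∣ (a - b) (b - c)) (ℚ.+-mono-≤ h k))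

  abs-plus : ∀ {a b c d δ ε} → abs (a - b) ≤ δ → abs (c - d) ≤ ε → abs (a + c - (b + d)) ≤ δ + ε
  abs-plus {a} {b} {c} {d} {δ} {ε} h k =
    subst (λ t → abs t ≤ δ + ε)
      (solve 4 (λ a b c d → a :- b :+ (c :- d) := a :+ c :- (b :+ d)) refl a b c d)
      (ℚ.≤-trans (ℚ.∣p+q∣≤∣p∣+∣q∣ (a - b) (c - d)) (ℚ.+-mono-≤ h k))

  abs-times : ∀ {a b c d A B δ ε} → abs a ≤ A → abs d ≤ B →
              abs (a - c) ≤ δ → abs (b - d) ≤ δ → (A + B) * δ ≤ ε → abs (a * b - c * d) ≤ ε
  abs-times {a} {b} {c} {d} {A} {B} {δ} {ε} ha hd hac hbd hε =
    subst (λ t → abs t ≤ ε)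
      (solve 4 (λ a b c d → a :* (b :- d) :+ (a :- c) :* d := a :* b :- c :* d) refl a b c d)
      (ℚ.≤-trans (ℚ.∣p+q∣≤∣p∣+∣q∣ (a * (b - d)) ((a - c) * d))
        (ℚ.≤-trans (subst₂ (λ s t → s + t ≤ A * δ + δ * B)
            (sym (ℚ.∣p*q∣≡∣p∣*∣q∣ a (b - d))) (sym (ℚ.∣p*q∣≡∣p∣*∣q∣ (a - c) d))
            (ℚ.+-mono-≤ (*-mono (ℚ.0≤∣p∣ a) (ℚ.0≤∣p∣ (b - d)) ha hbd)
                        (*-mono (ℚ.0≤∣p∣ (a - c)) (ℚ.0≤∣p∣ d) hac hd)))
          (subst (_≤ ε) (solve 3 (λ A B δ → (A :+ B) :* δ := A :* δ :+ δ :* B) refl A B δ) hε)))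

  -- The reciprocal, extended by inv 0 = 0.
  inv : ℚ → ℚ
  inv p with p ℚ.≟ 0ℚ
  ... | yes _  = 0ℚ
  ... | no p≢0 = ℚ.1/_ p {{ℚ.≢-nonZero p≢0}}

  *-inv : ∀ {p} → 0ℚ < p → p * inv p ≡ 1ℚ
  *-inv {p} 0<p with p ℚ.≟ 0ℚ
  ... | yes p≡0 = ⊥-elim (ℚ.<⇒≢ 0<p (sym p≡0))
  ... | no p≢0  = ℚ.*-inverseʳ p {{ℚ.≢-nonZero p≢0}}

  inv-pos : ∀ {p} → 0ℚ < p → 0ℚ < inv p
  inv-pos {p} 0<p with ℚ._<?_ 0ℚ (inv p)
  ... | yes h = h
  ... | no ¬h = ⊥-elim (ℚ.<-irrefl refl (ℚ.<-≤-trans 0<1 1≤0))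
    where
    1≤0 : 1ℚ ≤ 0ℚ
    1≤0 = cert (p * (0ℚ - inv p)) (*-nn (ℚ.<⇒≤ 0<p) (diff (ℚ.≮⇒≥ ¬h)))
      (trans (cong (_+ p * (0ℚ - inv p)) (sym (*-inv 0<p)))
        (solve 2 (λ p i → p :* i :+ p :* (con 0ℚ :- i) := con 0ℚ) refl p (inv p)))

  inv-diff : ∀ {p q} → 0ℚ < p → 0ℚ < q → inv p - inv q ≡ inv p * inv q * (q - p)
  inv-diff {p} {q} 0<p 0<q = sym (trans
    (solve 4 (λ p q i j → i :* j :* (q :- p) := i :* (q :* j) :- j :* (p :* i)) refl p q (inv p) (inv q))
    (trans (cong₂ (λ s t → inv p * s - inv q * t) (*-inv 0<q) (*-inv 0<p))
      (solve 2 (λ i j → i :* con 1ℚ :- j :* con 1ℚ := i :- j) refl (inv p) (inv q))))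

  inv-anti : ∀ {p q} → 0ℚ < p → p ≤ q → inv q ≤ inv p
  inv-anti {p} {q} 0<p p≤q =
    cert (inv p * inv q * (q - p))
      (*-nn (*-nn (ℚ.<⇒≤ (inv-pos 0<p)) (ℚ.<⇒≤ (inv-pos 0<q))) (diff p≤q))
      (trans (cong (inv q +_) (sym (inv-diff 0<p 0<q)))
        (solve 2 (λ i j → j :+ (i :- j) := i) refl (inv p) (inv q)))
    where 0<q = ℚ.<-≤-trans 0<p p≤q

  abs-inv : ∀ {a b c δ ε} → 0ℚ < c → c ≤ a → c ≤ b → abs (a - b) ≤ δ →
            inv c * inv c * δ ≤ ε → abs (inv a - inv b) ≤ ε
  abs-inv {a} {b} {c} {δ} {ε} 0<c c≤a c≤b h hε =
    ℚ.≤-trans (ℚ.≤-reflexive eq)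
      (ℚ.≤-trans (*-mono 0≤ij (ℚ.0≤∣p∣ (b - a))
                   (*-mono 0≤i 0≤j (inv-anti 0<c c≤a) (inv-anti 0<c c≤b))
                   (subst (_≤ δ) (abs-swap a b) h))
        hε)
    where
    0<a = ℚ.<-≤-trans 0<c c≤a
    0<b = ℚ.<-≤-trans 0<c c≤b
    0≤i = ℚ.<⇒≤ (inv-pos 0<a)
    0≤j = ℚ.<⇒≤ (inv-pos 0<b)
    0≤ij = *-nn 0≤i 0≤j
    eq : abs (inv a - inv b) ≡ inv a * inv b * abs (b - a)
    eq = trans (cong abs (inv-diff 0<a 0<b))
      (trans (ℚ.∣p*q∣≡∣p∣*∣q∣ (inv a * inv b) (b - a))
        (cong (_* abs (b - a)) (ℚ.0≤p⇒∣p∣≡p 0≤ij)))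

  shrink : ∀ {ε} B → 0ℚ < ε → 0ℚ ≤ B → ∃[ δ ] 0ℚ < δ × B * δ ≤ ε
  shrink {ε} B 0<ε 0≤B = δ , 0<δ , cert δ (ℚ.<⇒≤ 0<δ)
      (trans (solve 3 (λ B ε i → B :* (ε :* i) :+ ε :* i := (con 1ℚ :+ B) :* i :* ε) refl B ε (inv (1ℚ + B)))
        (trans (cong (_* ε) (*-inv 0<1+B)) (ℚ.*-identityˡ ε)))
    where
    0<1+B : 0ℚ < 1ℚ + B
    0<1+B = ℚ.+-mono-<-≤ {0ℚ} {1ℚ} {0ℚ} {B} 0<1 0≤B
    δ = ε * inv (1ℚ + B)
    0<δ = *-pos 0<ε (inv-pos 0<1+B)

  fromℕ : ℕ → ℚ
  fromℕ zero    = 0ℚ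
  fromℕ (suc n) = 1ℚ + fromℕ n

  fromℕ-nn : ∀ n → 0ℚ ≤ fromℕ n
  fromℕ-nn zero    = ℚ.≤-refl
  fromℕ-nn (suc n) = +-nn 0≤1 (fromℕ-nn n)

  fromℕ-mono : ∀ {m n} → m ℕ.≤ n → fromℕ m ≤ fromℕ n
  fromℕ-mono {n = n} ℕ.z≤n = fromℕ-nn n
  fromℕ-mono (ℕ.s≤s h)     = ℚ.+-monoʳ-≤ 1ℚ (fromℕ-mono h)

  fromℕ-≡ : ∀ n → fromℕ n ≡ ℚ.mkℚ (ℤ.+ n) 0 (Coprimality.sym (Coprimality.1-coprimeTo n))
  fromℕ-≡ zero    = refl
  fromℕ-≡ (suc n) = trans (cong (1ℚ +_) (fromℕ-≡ n)) (ℚ.toℚᵘ-injective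
    (ℚᵘ.≃-trans (ℚ.toℚᵘ-homo-+ 1ℚ (ℚ.mkℚ (ℤ.+ n) 0 (Coprimality.sym (Coprimality.1-coprimeTo n))))
      (ℚᵘ.*≡* (cong (ℤ._* ℤ.1ℤ) (cong (λ t → ℤ.1ℤ ℤ.+ t) (ℤ.*-identityʳ (ℤ.+ n)))))))

  archimedean : ∀ p → ∃[ N ] p ≤ fromℕ N
  archimedean p@(ℚ.mkℚ n d _) = ℤ.∣ n ∣ , subst (p ≤_) (sym (fromℕ-≡ ℤ.∣ n ∣)) (ℚ.*≤* le)
    where
    n≤∣n∣ : ∀ i → i ℤ.≤ ℤ.+ ℤ.∣ i ∣
    n≤∣n∣ (ℤ.+ _)    = ℤ.≤-refl
    n≤∣n∣ ℤ.-[1+ _ ] = ℤ.-≤+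
    le : n ℤ.* ℤ.1ℤ ℤ.≤ ℤ.+ ℤ.∣ n ∣ ℤ.* ℤ.+[1+ d ]
    le = ℤ.≤-trans (ℤ.≤-reflexive (ℤ.*-identityʳ n)) (ℤ.≤-trans (n≤∣n∣ n)
      (subst (ℤ.+ ℤ.∣ n ∣ ℤ.≤_) (ℤ.pos-* ℤ.∣ n ∣ (suc d)) (ℤ.+≤+ (ℕ.m≤m*n ℤ.∣ n ∣ (suc d)))))

  halves : ℕ → ℚ
  halves zero    = 1ℚ
  halves (suc n) = ½ * halves n

  halves-pos : ∀ n → 0ℚ < halves n
  halves-pos zero    = 0<1
  halves-pos (suc n) = *-pos 0<½ (halves-pos n)

  halves-bound : ∀ n → halves n * fromℕ (suc n) ≤ 1ℚ
  halves-bound zero    = ℚ.≤-refl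
  halves-bound (suc n) = ℚ.≤-trans
    (cert (½ * halves n * fromℕ n)
      (*-nn (ℚ.<⇒≤ (halves-pos (suc n))) (fromℕ-nn n))
      (solve 2 (λ h m → con ½ :* h :* (con 1ℚ :+ (con 1ℚ :+ m)) :+ con ½ :* h :* m := h :* (con 1ℚ :+ m))
        refl (halves n) (fromℕ n)))
    (halves-bound n)

  -- The bisection for the square root of p: after n halvings of the step
  -- 1 + ∣ p ∣ the root of p ≥ 0 lies in [ root p n , root p n + width p n ].
  width : ℚ → ℕ → ℚ
  width p zero    = 1ℚ + abs p
  width p (suc n) = ½ * width p n

  root : ℚ → ℕ → ℚ
  root p zero    = 0ℚ
  root p (suc n)
    with (root p n + width p (suc n)) * (root p n + width p (suc n)) ℚ.≤? p
  ... | yes _ = root p n + width p (suc n)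
  ... | no _  = root p n

  width-pos : ∀ p n → 0ℚ < width p n
  width-pos p zero    = ℚ.+-mono-<-≤ {0ℚ} {1ℚ} {0ℚ} {abs p} 0<1 (ℚ.0≤∣p∣ p)
  width-pos p (suc n) = *-pos 0<½ (width-pos p n)

  width-≡ : ∀ p n → width p n ≡ halves n * (1ℚ + abs p)
  width-≡ p zero    = sym (ℚ.*-identityˡ _)
  width-≡ p (suc n) = trans (cong (½ *_) (width-≡ p n)) (sym (ℚ.*-assoc ½ (halves n) _))

  root-nn : ∀ p n → 0ℚ ≤ root p n
  root-nn p zero = ℚ.≤-refl
  root-nn p (suc n)
    with (root p n + width p (suc n)) * (root p n + width p (suc n)) ℚ.≤? p
  ... | yes _ = +-nn (root-nn p n) (ℚ.<⇒≤ (width-pos p (suc n)))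
  ... | no _  = root-nn p n

  root-lower : ∀ p n → root p n ≡ 0ℚ ⊎ root p n * root p n ≤ p
  root-lower p zero = inj₁ refl
  root-lower p (suc n)
    with (root p n + width p (suc n)) * (root p n + width p (suc n)) ℚ.≤? p
  ... | yes h = inj₂ h
  ... | no _  = root-lower p n

  root-upper : ∀ p n → p ≤ (root p n + width p n) * (root p n + width p n)
  root-upper p zero = cert (1ℚ + abs p + abs p * abs p + (abs p - p))
    (+-nn (+-nn (+-nn 0≤1 (ℚ.0≤∣p∣ p)) (sq-nn (abs p))) (diff (p≤∣p∣ p)))
    (solve 2 (λ p a → p :+ (con 1ℚ :+ a :+ a :* a :+ (a :- p))
      := (con 0ℚ :+ (con 1ℚ :+ a)) :* (con 0ℚ :+ (con 1ℚ :+ a))) refl p (abs p))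
  root-upper p (suc n)
    with (root p n + width p (suc n)) * (root p n + width p (suc n)) ℚ.≤? p
  ... | no ¬h = ℚ.<⇒≤ (ℚ.≰⇒> ¬h)
  ... | yes _ = subst (p ≤_)
    (solve 2 (λ r w → (r :+ w) :* (r :+ w)
       := (r :+ con ½ :* w :+ con ½ :* w) :* (r :+ con ½ :* w :+ con ½ :* w)) refl (root p n) (width p n))
    (root-upper p n)

  root-close : ∀ {p q m n η} → 0ℚ < η → width q n ≤ η → abs (p - q) ≤ η * η →
               root p m ≤ root q n + (η + η)
  root-close {p} {q} {m} {n} {η} 0<η w≤η h with root p m ℚ.≤? root q n + (η + η)
  ... | yes r = r
  ... | no ¬r = ⊥-elim (ℚ.<-irrefl refl (ℚ.<-≤-trans s² (ℚ.≤-trans (lem (root-lower p m)) p≤)))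
    where
    s = root q n
    r = root p m
    s<r : s + (η + η) < r
    s<r = ℚ.≰⇒> ¬r
    0≤η = ℚ.<⇒≤ 0<η
    0≤s = root-nn q n
    0≤s+2η : 0ℚ ≤ s + (η + η)
    0≤s+2η = +-nn 0≤s (+-nn 0≤η 0≤η)
    lem : r ≡ 0ℚ ⊎ r * r ≤ p → r * r ≤ p
    lem (inj₂ k) = k
    lem (inj₁ e) = ⊥-elim (ℚ.<-irrefl refl (ℚ.≤-<-trans 0≤s+2η (subst (s + (η + η) <_) e s<r)))
    p≤ : p ≤ (s + η) * (s + η) + η * η
    p≤ = ℚ.≤-trans (upper h) (ℚ.+-monoˡ-≤ (η * η) (ℚ.≤-trans (root-upper q n)
      (*-mono 0≤sw 0≤sw sw sw)))
      where
      0≤sw = +-nn 0≤s (ℚ.<⇒≤ (width-pos q n))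
      sw : s + width q n ≤ s + η
      sw = ℚ.+-monoʳ-≤ s w≤η
    s² : (s + η) * (s + η) + η * η < r * r
    s² = ℚ.<-≤-trans
      (subst (_< (s + η) * (s + η) + η * η + (η * η + η * η)) (ℚ.+-identityʳ _)
        (ℚ.+-monoʳ-< ((s + η) * (s + η) + η * η)
          (ℚ.+-mono-< {0ℚ} {η * η} {0ℚ} {η * η} (*-pos 0<η 0<η) (*-pos 0<η 0<η))))
      (ℚ.≤-trans
        (cert (s * η + s * η) (+-nn (*-nn 0≤s 0≤η) (*-nn 0≤s 0≤η))
          (solve 2 (λ s η → (s :+ η) :* (s :+ η) :+ η :* η :+ (η :* η :+ η :* η) :+ (s :* η :+ s :* η)
            := (s :+ (η :+ η)) :* (s :+ (η :+ η))) refl s η))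
        (*-mono 0≤s+2η 0≤s+2η (ℚ.<⇒≤ s<r) (ℚ.<⇒≤ s<r)))

open Rational

------------------------------------------------------------------------
-- The real numbers, as Cauchy sequences of rationals

Eventually : (ℕ → Set) → Set
Eventually P = ∃[ N ] ∀ n → N ℕ.≤ n → P n

IsCauchy : (ℕ → ℚ) → Set
IsCauchy s = ∀ ε → 0ℚ ℚ.< ε →
  ∃[ N ] ∀ m n → N ℕ.≤ m → N ℕ.≤ n → abs (s m ℚ.- s n) ≤ ε

record ℝ : Set where
  constructor mkℝ
  field
    seq    : ℕ → ℚ
    cauchy : IsCauchy seq

open ℝ

infix 4 _≈ʳ_ _<ʳ_

_≈ʳ_ : ℝ → ℝ → Set
x ≈ʳ y = ∀ ε → 0ℚ ℚ.< ε → Eventually (λ n → abs (seq x n ℚ.- seq y n) ≤ ε)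

_<ʳ_ : ℝ → ℝ → Set
x <ʳ y = ∃[ ε ] 0ℚ ℚ.< ε × Eventually (λ n → seq x n ℚ.+ ε ≤ seq y n)

module _ where
  open import Data.Rational.Base using (_+_; _*_; _-_; -_; _<_)

  always : ∀ {P : ℕ → Set} → (∀ n → P n) → Eventually P
  always p = 0 , λ n _ → p n

  both : ∀ {P Q R : ℕ → Set} → (∀ n → P n → Q n → R n) → Eventually P → Eventually Q → Eventually R
  both f (M , p) (N , q) = M ℕ.⊔ N , λ n h →
    f n (p n (ℕ.≤-trans (ℕ.m≤m⊔n M N) h)) (q n (ℕ.≤-trans (ℕ.m≤n⊔m M N) h))

  after : ∀ {P Q : ℕ → Set} → (∀ n → P n → Q n) → Eventually P → Eventually Q
  after f (N , p) = N , λ n h → f n (p n h)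

  0<½* : ∀ {ε} → 0ℚ < ε → 0ℚ < ½ * ε
  0<½* = *-pos 0<½

  ≈ʳ-eventually : ∀ x y → Eventually (λ n → seq x n ≡ seq y n) → x ≈ʳ y
  ≈ʳ-eventually x y e ε 0<ε = after (λ n eq → abs-eq eq (ℚ.<⇒≤ 0<ε)) e

  ≈ʳ-pointwise : ∀ x y → (∀ n → seq x n ≡ seq y n) → x ≈ʳ y
  ≈ʳ-pointwise x y e = ≈ʳ-eventually x y (always e)

  ≈ʳ-refl : ∀ x → x ≈ʳ x
  ≈ʳ-refl x = ≈ʳ-pointwise x x (λ _ → refl)

  ≈ʳ-sym : ∀ x y → x ≈ʳ y → y ≈ʳ x
  ≈ʳ-sym x y h ε 0<ε = after (λ n → subst (_≤ ε) (abs-swap (seq x n) (seq y n))) (h ε 0<ε)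

  ≈ʳ-trans : ∀ x y z → x ≈ʳ y → y ≈ʳ z → x ≈ʳ z
  ≈ʳ-trans x y z h k ε 0<ε = both
    (λ n p q → subst (abs (seq x n - seq z n) ≤_) (half ε) (abs-trans {seq x n} {seq y n} {seq z n} p q))
    (h (½ * ε) (0<½* 0<ε)) (k (½ * ε) (0<½* 0<ε))

  bounded : ∀ x → ∃[ B ] 0ℚ ≤ B × Eventually (λ n → abs (seq x n) ≤ B)
  bounded x with cauchy x 1ℚ 0<1
  ... | N , h = 1ℚ + abs (seq x N) , +-nn 0≤1 (ℚ.0≤∣p∣ (seq x N)) , N , λ n N≤n →
    subst (λ t → abs t ≤ 1ℚ + abs (seq x N))
      (solve 2 (λ a b → a :- b :+ b := a) refl (seq x n) (seq x N))
      (ℚ.≤-trans (ℚ.∣p+q∣≤∣p∣+∣q∣ (seq x n - seq x N) (seq x N))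
        (ℚ.+-monoˡ-≤ (abs (seq x N)) (h n N N≤n ℕ.≤-refl)))

  abstract
    const-cauchy : ∀ p → IsCauchy (λ n → p)
    const-cauchy p ε 0<ε = 0 , λ _ _ _ _ → abs-eq {p} refl (ℚ.<⇒≤ 0<ε)

  fromℚ : ℚ → ℝ
  fromℚ p = mkℝ (λ _ → p) (const-cauchy p)

  0ʳ 1ʳ : ℝ
  0ʳ = fromℚ 0ℚ
  1ʳ = fromℚ 1ℚ

  infixl 6 _+ʳ_
  infixl 7 _*ʳ_
  infix  8 -ʳ_

  abstract
    +ʳ-cauchy : ∀ x y → IsCauchy (λ n → seq x n + seq y n)
    +ʳ-cauchy x y ε 0<ε =
      let M , p = cauchy x (½ * ε) (0<½* 0<ε)
          N , q = cauchy y (½ * ε) (0<½* 0<ε)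
      in M ℕ.⊔ N , λ m n hm hn →
        subst (abs (seq x m + seq y m - (seq x n + seq y n)) ≤_) (half ε)
          (abs-plus {seq x m} {seq x n} {seq y m} {seq y n}
            (p m n (ℕ.≤-trans (ℕ.m≤m⊔n M N) hm) (ℕ.≤-trans (ℕ.m≤m⊔n M N) hn))
            (q m n (ℕ.≤-trans (ℕ.m≤n⊔m M N) hm) (ℕ.≤-trans (ℕ.m≤n⊔m M N) hn)))

  _+ʳ_ : ℝ → ℝ → ℝ
  x +ʳ y = mkℝ (λ n → seq x n + seq y n) (+ʳ-cauchy x y)

  abs-neg : ∀ {a b ε} → abs (a - b) ≤ ε → abs (- a - - b) ≤ ε
  abs-neg {a} {b} {ε} = subst (_≤ ε) (trans (abs-swap a b)
    (cong abs (solve 2 (λ a b → b :- a := :- a :- (:- b)) refl a b)))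

  abstract
    -ʳ-cauchy : ∀ x → IsCauchy (λ n → - seq x n)
    -ʳ-cauchy x ε 0<ε =
      let N , p = cauchy x ε 0<ε in N , λ m n hm hn → abs-neg {seq x m} {seq x n} (p m n hm hn)

  -ʳ_ : ℝ → ℝ
  -ʳ x = mkℝ (λ n → - seq x n) (-ʳ-cauchy x)

  abstract
    *ʳ-cauchy : ∀ x y → IsCauchy (λ n → seq x n * seq y n)
    *ʳ-cauchy x y ε 0<ε =
      let A , 0≤A , K , hA = bounded x
          B , 0≤B , L , hB = bounded y
          δ , 0<δ , hδ = shrink (A + B) 0<ε (+-nn 0≤A 0≤B)
          M , p = cauchy x δ 0<δ
          N , q = cauchy y δ 0<δ
          KL≤ = ℕ.m≤m⊔n (K ℕ.⊔ L) (M ℕ.⊔ N)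
          MN≤ = ℕ.m≤n⊔m (K ℕ.⊔ L) (M ℕ.⊔ N)
          K≤ = ℕ.≤-trans (ℕ.m≤m⊔n K L) KL≤
          L≤ = ℕ.≤-trans (ℕ.m≤n⊔m K L) KL≤
          M≤ = ℕ.≤-trans (ℕ.m≤m⊔n M N) MN≤
          N≤ = ℕ.≤-trans (ℕ.m≤n⊔m M N) MN≤
      in (K ℕ.⊔ L) ℕ.⊔ (M ℕ.⊔ N) , λ m n hm hn →
        abs-times {seq x m} {seq y m} {seq x n} {seq y n}
          (hA m (ℕ.≤-trans K≤ hm)) (hB n (ℕ.≤-trans L≤ hn))
          (p m n (ℕ.≤-trans M≤ hm) (ℕ.≤-trans M≤ hn))
          (q m n (ℕ.≤-trans N≤ hm) (ℕ.≤-trans N≤ hn)) hδ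

  _*ʳ_ : ℝ → ℝ → ℝ
  x *ʳ y = mkℝ (λ n → seq x n * seq y n) (*ʳ-cauchy x y)

  +ʳ-cong : ∀ x y u v → x ≈ʳ y → u ≈ʳ v → x +ʳ u ≈ʳ y +ʳ v
  +ʳ-cong x y u v h k ε 0<ε = both
    (λ n p q → subst (abs (seq x n + seq u n - (seq y n + seq v n)) ≤_) (half ε)
      (abs-plus {seq x n} {seq y n} {seq u n} {seq v n} p q))
    (h (½ * ε) (0<½* 0<ε)) (k (½ * ε) (0<½* 0<ε))

  -ʳ-cong : ∀ x y → x ≈ʳ y → -ʳ x ≈ʳ -ʳ y
  -ʳ-cong x y h ε 0<ε = after (λ n → abs-neg {seq x n} {seq y n}) (h ε 0<ε)

  *ʳ-cong : ∀ x y u v → x ≈ʳ y → u ≈ʳ v → x *ʳ u ≈ʳ y *ʳ v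
  *ʳ-cong x y u v h k ε 0<ε =
    let A , 0≤A , hA = bounded x
        B , 0≤B , hB = bounded v
        δ , 0<δ , hδ = shrink (A + B) 0<ε (+-nn 0≤A 0≤B)
    in both (λ n (a , b) (p , q) →
               abs-times {seq x n} {seq u n} {seq y n} {seq v n} a b p q hδ)
         (both (λ _ → _,_) hA hB) (both (λ _ → _,_) (h δ 0<δ) (k δ 0<δ))

  abstract
    recip-cauchy : ∀ x → 0ʳ <ʳ x → IsCauchy (λ n → inv (seq x n))
    recip-cauchy x (c , 0<c , K , c≤) ε 0<ε =
      let δ , 0<δ , hδ = shrink (inv c * inv c) 0<ε (sq-nn (inv c))
          M , p = cauchy x δ 0<δ
          c≤x : ∀ n → K ℕ.⊔ M ℕ.≤ n → c ≤ seq x n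
          c≤x n h = subst (_≤ seq x n) (ℚ.+-identityˡ c) (c≤ n (ℕ.≤-trans (ℕ.m≤m⊔n K M) h))
      in K ℕ.⊔ M , λ m n hm hn →
        abs-inv 0<c (c≤x m hm) (c≤x n hn)
          (p m n (ℕ.≤-trans (ℕ.m≤n⊔m K M) hm) (ℕ.≤-trans (ℕ.m≤n⊔m K M) hn)) hδ

  -- The reciprocal of a positive real number.
  recip : (x : ℝ) → 0ʳ <ʳ x → ℝ
  recip x 0<x = mkℝ (λ n → inv (seq x n)) (recip-cauchy x 0<x)

  *ʳ-recip : ∀ x (0<x : 0ʳ <ʳ x) → x *ʳ recip x 0<x ≈ʳ 1ʳ
  *ʳ-recip x 0<x@(c , 0<c , ev) = ≈ʳ-eventually (x *ʳ recip x 0<x) 1ʳ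
    (after (λ n h → *-inv (ℚ.<-≤-trans 0<c (subst (_≤ seq x n) (ℚ.+-identityˡ c) h))) ev)

  width-small : ∀ x ε → 0ℚ < ε → Eventually (λ n → width (seq x n) n ≤ ε)
  width-small x ε 0<ε = both (λ n b N≤n → lem n b (fromℕ-mono N≤n)) hB (N , λ _ h → h)
    where
    B   = proj₁ (bounded x)
    0≤B = proj₁ (proj₂ (bounded x))
    hB  = proj₂ (proj₂ (bounded x))
    N   = proj₁ (archimedean ((1ℚ + B) * inv ε))
    hN  = proj₂ (archimedean ((1ℚ + B) * inv ε))
    1+B≤ : ∀ n → fromℕ N ≤ fromℕ n → 1ℚ + B ≤ fromℕ (suc n) * ε
    1+B≤ n h = ℚ.≤-trans
      (subst (_≤ fromℕ N * ε)
        (trans (solve 3 (λ b i e → b :* i :* e := e :* i :* b) refl (1ℚ + B) (inv ε) ε)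
          (trans (cong (_* (1ℚ + B)) (*-inv 0<ε)) (ℚ.*-identityˡ _)))
        (*-mono (*-nn (+-nn 0≤1 0≤B) (ℚ.<⇒≤ (inv-pos 0<ε))) (ℚ.<⇒≤ 0<ε) hN ℚ.≤-refl))
      (cert ((fromℕ n - fromℕ N) * ε + ε)
        (+-nn (*-nn (diff h) (ℚ.<⇒≤ 0<ε)) (ℚ.<⇒≤ 0<ε))
        (solve 3 (λ m n e → m :* e :+ ((n :- m) :* e :+ e) := (con 1ℚ :+ n) :* e) refl (fromℕ N) (fromℕ n) ε))
    lem : ∀ n → abs (seq x n) ≤ B → fromℕ N ≤ fromℕ n → width (seq x n) n ≤ ε
    lem n b h = ℚ.≤-trans (ℚ.≤-reflexive (width-≡ (seq x n) n))
      (ℚ.≤-trans (*-mono 0≤h (+-nn 0≤1 (ℚ.0≤∣p∣ (seq x n))) ℚ.≤-refl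
                    (ℚ.≤-trans (ℚ.+-monoʳ-≤ 1ℚ b) (1+B≤ n h)))
        (subst₂ _≤_ (ℚ.*-assoc (halves n) (fromℕ (suc n)) ε) (ℚ.*-identityˡ ε)
          (*-mono (*-nn 0≤h (fromℕ-nn (suc n))) (ℚ.<⇒≤ 0<ε) (halves-bound n) ℚ.≤-refl)))
      where 0≤h = ℚ.<⇒≤ (halves-pos n)

  abstract
    √-cauchy : ∀ x → IsCauchy (λ n → root (seq x n) n)
    √-cauchy x ε 0<ε =
      let η   = ½ * ε
          0<η = 0<½* 0<ε
          M , p = cauchy x (η * η) (*-pos 0<η 0<η)
          N , w = width-small x η 0<η
          le : ∀ m n → M ℕ.⊔ N ℕ.≤ m → M ℕ.⊔ N ℕ.≤ n → root (seq x m) m ≤ root (seq x n) n + ε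
          le m n hm hn = subst (λ t → root (seq x m) m ≤ root (seq x n) n + t) (half ε)
            (root-close {seq x m} {seq x n} {m} {n} 0<η (w n (ℕ.≤-trans (ℕ.m≤n⊔m M N) hn))
              (p m n (ℕ.≤-trans (ℕ.m≤m⊔n M N) hm) (ℕ.≤-trans (ℕ.m≤m⊔n M N) hn)))
      in M ℕ.⊔ N , λ m n hm hn → close (le m n hm hn) (le n m hn hm)

  infix 8 √_

  -- The square root, extended by 0 to the negative numbers; see √-square.
  √_ : ℝ → ℝ
  √ x = mkℝ (λ n → root (seq x n) n) (√-cauchy x)

  root-square : ∀ {p n} → 0ℚ ≤ p → root p n * root p n ≤ p
  root-square {p} {n} 0≤p with root-lower p n
  ... | inj₂ h = h
  ... | inj₁ e = subst (_≤ p) (sym (trans (cong₂ _*_ e e) (ℚ.*-zeroˡ 0ℚ))) 0≤p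

  √-square : ∀ x → (∀ n → 0ℚ ≤ seq x n) → √ x *ʳ √ x ≈ʳ x
  √-square x 0≤x ε 0<ε =
    let B , 0≤B , hB = bounded (√ x)
        δ , 0<δ , hδ = shrink (1ℚ + (B + B)) 0<ε (+-nn 0≤1 (+-nn 0≤B 0≤B))
        η   = δ ℚ.⊓ 1ℚ
        0<η = mono⊓ 0<δ
        w   = width-small x η 0<η
    in both (λ n b h → lem n B δ 0≤B (ℚ.<⇒≤ 0<δ) b
              (ℚ.≤-trans h (ℚ.p⊓q≤p δ 1ℚ)) (ℚ.≤-trans h (ℚ.p⊓q≤q δ 1ℚ)) hδ) hB w
    where
    mono⊓ : ∀ {δ} → 0ℚ < δ → 0ℚ < δ ℚ.⊓ 1ℚ
    mono⊓ {δ} 0<δ with ℚ.≤-total δ 1ℚ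
    ... | inj₁ h = subst (0ℚ <_) (sym (ℚ.p≤q⇒p⊓q≡p h)) 0<δ
    ... | inj₂ h = subst (0ℚ <_) (sym (ℚ.p≥q⇒p⊓q≡q h)) 0<1
    lem : ∀ n B δ → 0ℚ ≤ B → 0ℚ ≤ δ → abs (root (seq x n) n) ≤ B →
          width (seq x n) n ≤ δ → width (seq x n) n ≤ 1ℚ → (1ℚ + (B + B)) * δ ≤ ε →
          abs (root (seq x n) n * root (seq x n) n - seq x n) ≤ ε
    lem n B δ 0≤B 0≤δ b wδ w1 hε = close
      (ℚ.≤-trans (root-square {seq x n} {n} (0≤x n)) (cert ε (ℚ.<⇒≤ 0<ε) refl))
      (ℚ.≤-trans (root-upper (seq x n) n)
        (ℚ.≤-trans (cert (w * (1ℚ - w) + (w * (B - r) + w * (B - r)) + (1ℚ + (B + B)) * (δ - w))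
          (+-nn (+-nn (*-nn 0≤w (diff w1)) (+-nn (*-nn 0≤w (diff r≤B)) (*-nn 0≤w (diff r≤B))))
            (*-nn (+-nn 0≤1 (+-nn 0≤B 0≤B)) (diff wδ)))
          (solve 4 (λ r w B δ → (r :+ w) :* (r :+ w) :+ (w :* (con 1ℚ :- w)
              :+ (w :* (B :- r) :+ w :* (B :- r)) :+ (con 1ℚ :+ (B :+ B)) :* (δ :- w))
              := r :* r :+ (con 1ℚ :+ (B :+ B)) :* δ) refl r w B δ))
          (ℚ.+-monoʳ-≤ (r * r) hε)))
      where
      r = root (seq x n) n
      w = width (seq x n) n
      0≤w = ℚ.<⇒≤ (width-pos (seq x n) n)
      r≤B : r ≤ B
      r≤B = ℚ.≤-trans (p≤∣p∣ r) b

  0<√⇒0< : ∀ x → 0ʳ <ʳ √ x → 0ʳ <ʳ x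
  0<√⇒0< x (c , 0<c , ev) = c * c , *-pos 0<c 0<c , after lem ev
    where
    lem : ∀ n → 0ℚ + c ≤ root (seq x n) n → 0ℚ + c * c ≤ seq x n
    lem n h = subst (_≤ seq x n) (sym (ℚ.+-identityˡ (c * c))) (sq (root-lower (seq x n) n))
      where
      r = root (seq x n) n
      c≤r : c ≤ r
      c≤r = subst (_≤ r) (ℚ.+-identityˡ c) h
      sq : r ≡ 0ℚ ⊎ r * r ≤ seq x n → c * c ≤ seq x n
      sq (inj₁ e) = ⊥-elim (ℚ.<-irrefl refl (ℚ.<-≤-trans 0<c (subst (c ≤_) e c≤r)))
      sq (inj₂ k) = ℚ.≤-trans (*-mono (ℚ.<⇒≤ 0<c) (ℚ.<⇒≤ 0<c) c≤r c≤r) k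

  √<1⇒<1 : ∀ x → √ x <ʳ 1ʳ → x <ʳ 1ʳ
  √<1⇒<1 x (c , 0<c , ev) = η , 0<η , both lem ev (width-small x η 0<η)
    where
    η = ½ * c
    0<η = 0<½* 0<c
    lem : ∀ n → root (seq x n) n + c ≤ 1ℚ → width (seq x n) n ≤ η → seq x n + η ≤ 1ℚ
    lem n h k = ℚ.≤-trans (ℚ.+-monoˡ-≤ η (ℚ.≤-trans (root-upper (seq x n) n)
        (*-mono 0≤s 0≤s s≤1 s≤1-η)))
      (ℚ.≤-reflexive (solve 1 (λ η → con 1ℚ :* (con 1ℚ :- η) :+ η := con 1ℚ) refl η))
      where
      r = root (seq x n) n
      w = width (seq x n) n
      0≤s : 0ℚ ≤ r + w
      0≤s = +-nn (root-nn (seq x n) n) (ℚ.<⇒≤ (width-pos (seq x n) n))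
      s≤1-η : r + w ≤ 1ℚ - η
      s≤1-η = cert ((η - w) + (1ℚ - (r + c))) (+-nn (diff k) (diff h))
        (solve 3 (λ r w c → r :+ w :+ ((con ½ :* c :- w) :+ (con 1ℚ :- (r :+ c)))
          := con 1ℚ :- con ½ :* c) refl r w c)
      s≤1 : r + w ≤ 1ℚ
      s≤1 = ℚ.≤-trans s≤1-η (cert η (ℚ.<⇒≤ 0<η)
        (solve 1 (λ η → con 1ℚ :- η :+ η := con 1ℚ) refl η))

------------------------------------------------------------------------
-- The complex numbers

infix 4 _≈ᶜ_

record ℂ : Set where
  constructor _+i_
  field
    re im : ℝ

open ℂ

record _≈ᶜ_ (z w : ℂ) : Set where
  constructor _,_
  field
    re-≈ : re z ≈ʳ re w
    im-≈ : im z ≈ʳ im w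

open _≈ᶜ_

0ᶜ 1ᶜ : ℂ
0ᶜ = 0ʳ +i 0ʳ
1ᶜ = 1ʳ +i 0ʳ

infixl 6 _+ᶜ_
infixl 7 _*ᶜ_
infix  8 -ᶜ_

_+ᶜ_ _*ᶜ_ : ℂ → ℂ → ℂ
z +ᶜ w = (re z +ʳ re w) +i (im z +ʳ im w)
z *ᶜ w = (re z *ʳ re w +ʳ -ʳ (im z *ʳ im w)) +i (re z *ʳ im w +ʳ im z *ʳ re w)

-ᶜ_ : ℂ → ℂ
-ᶜ z = (-ʳ re z) +i (-ʳ im z)

private
  pointwise : ∀ {z w} → (∀ n → seq (re z) n ≡ seq (re w) n) →
              (∀ n → seq (im z) n ≡ seq (im w) n) → z ≈ᶜ w
  pointwise {z} {w} p q = ≈ʳ-pointwise (re z) (re w) p , ≈ʳ-pointwise (im z) (im w) q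

  ≈ᶜ-sym : ∀ {z w} → z ≈ᶜ w → w ≈ᶜ z
  ≈ᶜ-sym {z} {w} (p , q) = ≈ʳ-sym (re z) (re w) p , ≈ʳ-sym (im z) (im w) q

  ≈ᶜ-trans : ∀ {z w v} → z ≈ᶜ w → w ≈ᶜ v → z ≈ᶜ v
  ≈ᶜ-trans {z} {w} {v} (p , q) (p′ , q′) =
    ≈ʳ-trans (re z) (re w) (re v) p p′ , ≈ʳ-trans (im z) (im w) (im v) q q′

  +ᶜ-cong : ∀ {z w u v} → z ≈ᶜ w → u ≈ᶜ v → z +ᶜ u ≈ᶜ w +ᶜ v
  +ᶜ-cong {z} {w} {u} {v} (p , q) (p′ , q′) =
    +ʳ-cong (re z) (re w) (re u) (re v) p p′ , +ʳ-cong (im z) (im w) (im u) (im v) q q′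

  -ᶜ-cong : ∀ {z w} → z ≈ᶜ w → -ᶜ z ≈ᶜ -ᶜ w
  -ᶜ-cong {z} {w} (p , q) = -ʳ-cong (re z) (re w) p , -ʳ-cong (im z) (im w) q

  *ᶜ-cong : ∀ {z w u v} → z ≈ᶜ w → u ≈ᶜ v → z *ᶜ u ≈ᶜ w *ᶜ v
  *ᶜ-cong {z} {w} {u} {v} (p , q) (p′ , q′) =
    +ʳ-cong (re z *ʳ re u) (re w *ʳ re v) (-ʳ (im z *ʳ im u)) (-ʳ (im w *ʳ im v))
      (*ʳ-cong (re z) (re w) (re u) (re v) p p′)
      (-ʳ-cong (im z *ʳ im u) (im w *ʳ im v) (*ʳ-cong (im z) (im w) (im u) (im v) q q′)) ,
    +ʳ-cong (re z *ʳ im u) (re w *ʳ im v) (im z *ʳ re u) (im w *ʳ re v)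
      (*ʳ-cong (re z) (re w) (im u) (im v) p q′)
      (*ʳ-cong (im z) (im w) (re u) (re v) q p′)

  *ᶜ-assoc : ∀ z w v → (z *ᶜ w) *ᶜ v ≈ᶜ z *ᶜ (w *ᶜ v)
  *ᶜ-assoc (x +i y) (a +i b) (c +i d) = pointwise
    (λ n → solve 6 (λ x y a b c d →
        (x :* a :+ :- (y :* b)) :* c :+ :- ((x :* b :+ y :* a) :* d)
        := x :* (a :* c :+ :- (b :* d)) :+ :- (y :* (a :* d :+ b :* c)))
      refl (seq x n) (seq y n) (seq a n) (seq b n) (seq c n) (seq d n))
    (λ n → solve 6 (λ x y a b c d →
        (x :* a :+ :- (y :* b)) :* d :+ (x :* b :+ y :* a) :* c
        := x :* (a :* d :+ b :* c) :+ y :* (a :* c :+ :- (b :* d)))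
      refl (seq x n) (seq y n) (seq a n) (seq b n) (seq c n) (seq d n))

  *ᶜ-comm : ∀ z w → z *ᶜ w ≈ᶜ w *ᶜ z
  *ᶜ-comm (x +i y) (a +i b) = pointwise
    (λ n → solve 4 (λ x y a b → x :* a :+ :- (y :* b) := a :* x :+ :- (b :* y))
      refl (seq x n) (seq y n) (seq a n) (seq b n))
    (λ n → solve 4 (λ x y a b → x :* b :+ y :* a := a :* y :+ b :* x)
      refl (seq x n) (seq y n) (seq a n) (seq b n))

  *ᶜ-identityˡ : ∀ z → 1ᶜ *ᶜ z ≈ᶜ z
  *ᶜ-identityˡ (x +i y) = pointwise
    (λ n → solve 2 (λ x y → con 1ℚ :* x :+ :- (con 0ℚ :* y) := x) refl (seq x n) (seq y n))
    (λ n → solve 2 (λ x y → con 1ℚ :* y :+ con 0ℚ :* x := y) refl (seq x n) (seq y n))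

  *ᶜ-distribˡ : ∀ z w v → z *ᶜ (w +ᶜ v) ≈ᶜ z *ᶜ w +ᶜ z *ᶜ v
  *ᶜ-distribˡ (x +i y) (a +i b) (c +i d) = pointwise
    (λ n → solve 6 (λ x y a b c d → x :* (a :+ c) :+ :- (y :* (b :+ d))
        := (x :* a :+ :- (y :* b)) :+ (x :* c :+ :- (y :* d)))
      refl (seq x n) (seq y n) (seq a n) (seq b n) (seq c n) (seq d n))
    (λ n → solve 6 (λ x y a b c d → x :* (b :+ d) :+ y :* (a :+ c)
        := (x :* b :+ y :* a) :+ (x :* d :+ y :* c))
      refl (seq x n) (seq y n) (seq a n) (seq b n) (seq c n) (seq d n))

ℂ-isCommutativeRing : IsCommutativeRing _≈ᶜ_ _+ᶜ_ _*ᶜ_ -ᶜ_ 0ᶜ 1ᶜ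
ℂ-isCommutativeRing = record
  { isRing = record
    { +-isAbelianGroup = record
      { isGroup = record
        { isMonoid = record
          { isSemigroup = record
            { isMagma = record
              { isEquivalence = record
                { refl  = pointwise (λ _ → refl) (λ _ → refl)
                ; sym   = ≈ᶜ-sym
                ; trans = ≈ᶜ-trans
                }
              ; ∙-cong = +ᶜ-cong
              }
            ; assoc = λ z w v → pointwise
                (λ n → ℚ.+-assoc (seq (re z) n) (seq (re w) n) (seq (re v) n))
                (λ n → ℚ.+-assoc (seq (im z) n) (seq (im w) n) (seq (im v) n))
            }
          ; identity =
              (λ z → pointwise (λ n → ℚ.+-identityˡ (seq (re z) n)) (λ n → ℚ.+-identityˡ (seq (im z) n))) ,
              (λ z → pointwise (λ n → ℚ.+-identityʳ (seq (re z) n)) (λ n → ℚ.+-identityʳ (seq (im z) n)))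
          }
        ; inverse =
            (λ z → pointwise (λ n → ℚ.+-inverseˡ (seq (re z) n)) (λ n → ℚ.+-inverseˡ (seq (im z) n))) ,
            (λ z → pointwise (λ n → ℚ.+-inverseʳ (seq (re z) n)) (λ n → ℚ.+-inverseʳ (seq (im z) n)))
        ; ⁻¹-cong = -ᶜ-cong
        }
      ; comm = λ z w → pointwise
          (λ n → ℚ.+-comm (seq (re z) n) (seq (re w) n))
          (λ n → ℚ.+-comm (seq (im z) n) (seq (im w) n))
      }
    ; *-cong = *ᶜ-cong
    ; *-assoc = *ᶜ-assoc
    ; *-identity = *ᶜ-identityˡ , λ z → ≈ᶜ-trans (*ᶜ-comm z 1ᶜ) (*ᶜ-identityˡ z)
    ; distrib = *ᶜ-distribˡ , λ z w v → ≈ᶜ-trans (*ᶜ-comm (w +ᶜ v) z)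
        (≈ᶜ-trans (*ᶜ-distribˡ z w v) (+ᶜ-cong (*ᶜ-comm z w) (*ᶜ-comm z v)))
    }
  ; *-comm = *ᶜ-comm
  }

ℂ-commutativeRing : CommutativeRing 0ℓ 0ℓ
ℂ-commutativeRing = record { isCommutativeRing = ℂ-isCommutativeRing }

open CommutativeRing ℂ-commutativeRing public
  using (_≈_; _+_; _*_; _-_; -_; 0#; 1#)
open import Algebra.Properties.Semiring.Exp (CommutativeRing.semiring ℂ-commutativeRing) public
  using (_^_)
open import Algebra.Definitions.RawSemiring
  (Semiring.rawSemiring (CommutativeRing.semiring ℂ-commutativeRing)) public
  using (sum; product)

normSq : ℂ → ℝ
normSq z = re z *ʳ re z +ʳ im z *ʳ im z

∣_∣ : ℂ → ℝ
∣ z ∣ = √ normSq z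

infix 4 _#0

-- Being nonzero, in the positive sense that 0 < |z|².
_#0 : ℂ → Set
z #0 = 0ʳ <ʳ normSq z

_⁻¹[_] : (z : ℂ) → z #0 → ℂ
z ⁻¹[ z#0 ] = (re z *ʳ recip (normSq z) z#0) +i (-ʳ im z *ʳ recip (normSq z) z#0)

⁻¹-inverseʳ : ∀ z z#0 → z * z ⁻¹[ z#0 ] ≈ 1#
⁻¹-inverseʳ (x +i y) z#0 =
  ≈ʳ-trans (re u) (N *ʳ r) 1ʳ
    (≈ʳ-pointwise (re u) (N *ʳ r) (λ n →
      solve 3 (λ x y r → x :* (x :* r) :+ :- (y :* (:- y :* r)) := (x :* x :+ y :* y) :* r)
        refl (seq x n) (seq y n) (seq r n)))
    (*ʳ-recip N z#0) ,
  ≈ʳ-pointwise (im u) 0ʳ (λ n →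
      solve 3 (λ x y r → x :* (:- y :* r) :+ y :* (x :* r) := con 0ℚ)
        refl (seq x n) (seq y n) (seq r n))
  where
  N = normSq (x +i y)
  r = recip N z#0
  u = (x +i y) * (x +i y) ⁻¹[ z#0 ]

normSq-nn : ∀ z n → 0ℚ ≤ seq (normSq z) n
normSq-nn z n = +-nn (sq-nn (seq (re z) n)) (sq-nn (seq (im z) n))

normSq-* : ∀ z w n → seq (normSq (z * w)) n ≡ seq (normSq z) n ℚ.* seq (normSq w) n
normSq-* (x +i y) (a +i b) n = solve 4 (λ x y a b →
    (x :* a :+ :- (y :* b)) :* (x :* a :+ :- (y :* b)) :+ (x :* b :+ y :* a) :* (x :* b :+ y :* a)
    := (x :* x :+ y :* y) :* (a :* a :+ b :* b))
  refl (seq x n) (seq y n) (seq a n) (seq b n)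

-- ∣ z ∣ is given by nonnegative approximations (root-nn), so this identifies it
-- as the usual modulus.
∣-∣-square : ∀ z → ∣ z ∣ *ʳ ∣ z ∣ ≈ʳ normSq z
∣-∣-square z = √-square (normSq z) (normSq-nn z)

0<∣-∣⇒#0 : ∀ z → 0ʳ <ʳ ∣ z ∣ → z #0
0<∣-∣⇒#0 z = 0<√⇒0< (normSq z)

1#0 : 1# #0
1#0 = 1ℚ , 0<1 , always (λ _ → ℚ.≤-refl)

-1#0 : (- 1#) #0
-1#0 = 1ℚ , 0<1 , always (λ _ → ℚ.≤-refl)

*-#0 : ∀ {z w} → z #0 → w #0 → z * w #0
*-#0 {z} {w} (c , 0<c , p) (d , 0<d , q) = c ℚ.* d , *-pos 0<c 0<d , both lem p q
  where
  lem : ∀ n → 0ℚ ℚ.+ c ≤ seq (normSq z) n → 0ℚ ℚ.+ d ≤ seq (normSq w) n →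
        0ℚ ℚ.+ c ℚ.* d ≤ seq (normSq (z * w)) n
  lem n h k = subst₂ _≤_ (sym (ℚ.+-identityˡ (c ℚ.* d))) (sym (normSq-* z w n))
    (*-mono (ℚ.<⇒≤ 0<c) (ℚ.<⇒≤ 0<d)
      (subst (_≤ seq (normSq z) n) (ℚ.+-identityˡ c) h)
      (subst (_≤ seq (normSq w) n) (ℚ.+-identityˡ d) k))

product-#0 : ∀ {n} (f : Fin n → ℂ) → (∀ i → f i #0) → product f #0
product-#0 {zero}  f h = 1#0
product-#0 {suc n} f h = *-#0 {f Fin.zero} {product (λ i → f (Fin.suc i))}
  (h Fin.zero) (product-#0 (λ i → f (Fin.suc i)) (λ i → h (Fin.suc i)))

1-z#0 : ∀ z → normSq z <ʳ 1ʳ → (1# - z) #0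
1-z#0 z (c , 0<c , p) = η ℚ.* η , *-pos 0<η 0<η , after lem p
  where
  η = ½ ℚ.* c
  0<η = 0<½* 0<c
  lem : ∀ n → seq (normSq z) n ℚ.+ c ≤ 1ℚ → 0ℚ ℚ.+ η ℚ.* η ≤ seq (normSq (1# - z)) n
  lem n h = cert ((1ℚ ℚ.- x ℚ.- η) ℚ.* (1ℚ ℚ.- x ℚ.+ η) ℚ.+ y ℚ.* y)
      (+-nn (*-nn 0≤d (ℚ.≤-trans 0≤d (cert (η ℚ.+ η) (+-nn 0≤η 0≤η)
          (solve 2 (λ x η → con 1ℚ :- x :- η :+ (η :+ η) := con 1ℚ :- x :+ η) refl x η))))
        (sq-nn y))
      (solve 3 (λ x y η →
          con 0ℚ :+ η :* η :+ ((con 1ℚ :- x :- η) :* (con 1ℚ :- x :+ η) :+ y :* y)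
          := (con 1ℚ :+ :- x) :* (con 1ℚ :+ :- x) :+ (con 0ℚ :+ :- y) :* (con 0ℚ :+ :- y))
        refl x y η)
    where
    x = seq (re z) n
    y = seq (im z) n
    0≤η = ℚ.<⇒≤ 0<η
    -- 2 (1 - x - η) = (1 - x² - y² - c) + (1 - x)² + y²
    0≤d : 0ℚ ≤ 1ℚ ℚ.- x ℚ.- η
    0≤d = subst (0ℚ ≤_)
      (solve 3 (λ x y c → con ½ :* ((con 1ℚ :- (x :* x :+ y :* y :+ c))
            :+ ((con 1ℚ :- x) :* (con 1ℚ :- x) :+ y :* y))
          := con 1ℚ :- x :- con ½ :* c) refl x y c)
      (*-nn (ℚ.<⇒≤ 0<½) (+-nn (diff h) (+-nn (sq-nn (1ℚ ℚ.- x)) (sq-nn y))))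

normSq-*-≤ : ∀ z w → Eventually (λ n → seq (normSq z) n ≤ 1ℚ) →
             Eventually (λ n → seq (normSq w) n ≤ 1ℚ) → Eventually (λ n → seq (normSq (z * w)) n ≤ 1ℚ)
normSq-*-≤ z w = both (λ n h k → subst (_≤ 1ℚ) (sym (normSq-* z w n))
  (*-mono {b = 1ℚ} {d = 1ℚ} (normSq-nn z n) (normSq-nn w n) h k))

normSq-^-≤ : ∀ z j → Eventually (λ n → seq (normSq z) n ≤ 1ℚ) →
             Eventually (λ n → seq (normSq (z ^ j)) n ≤ 1ℚ)
normSq-^-≤ z zero    h = always (λ _ → ℚ.≤-refl)
normSq-^-≤ z (suc j) h = normSq-*-≤ z (z ^ j) h (normSq-^-≤ z j h)

normSq-*^-< : ∀ z j → normSq z <ʳ 1ʳ → normSq (z * z ^ j) <ʳ 1ʳ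
normSq-*^-< z j (c , 0<c , p) = c , 0<c , both lem p (normSq-^-≤ z j (after weaken p))
  where
  weaken : ∀ n → seq (normSq z) n ℚ.+ c ≤ 1ℚ → seq (normSq z) n ≤ 1ℚ
  weaken n h = ℚ.≤-trans (cert c (ℚ.<⇒≤ 0<c) refl) h
  lem : ∀ n → seq (normSq z) n ℚ.+ c ≤ 1ℚ → seq (normSq (z ^ j)) n ≤ 1ℚ →
        seq (normSq (z * z ^ j)) n ℚ.+ c ≤ 1ℚ
  lem n h k = ℚ.≤-trans (ℚ.+-monoˡ-≤ c
    (subst₂ _≤_ (sym (normSq-* z (z ^ j) n)) (ℚ.*-identityʳ (seq (normSq z) n))
      (*-mono {d = 1ℚ} (normSq-nn z n) (normSq-nn (z ^ j) n) ℚ.≤-refl k))) h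

-- Integer powers of a nonzero complex number.
power : (z : ℂ) → z #0 → ℤ → ℂ
power z z#0 (ℤ.+ n)    = z ^ n
power z z#0 ℤ.-[1+ n ] = (z ⁻¹[ z#0 ]) ^ suc n

[-1]^_ : ℤ → ℂ
[-1]^_ = power (- 1#) -1#0

-- ∑ a b f is the sum of f k over the integers k with a ≤ k ≤ b.
∑ : ℤ → ℤ → (ℤ → ℂ) → ℂ
∑ a b f = sum {terms (ℤ.suc b ℤ.- a)} (λ i → f (a ℤ.+ ℤ.+ toℕ i))
  where
  terms : ℤ → ℕ
  terms (ℤ.+ n)    = n
  terms ℤ.-[1+ _ ] = 0

------------------------------------------------------------------------
-- q-series

-- (a;q)ₙ
poch : ℂ → ℂ → ℕ → ℂ
poch a q n = product {n} (λ j → 1# - a * q ^ toℕ j)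

poch-#0 : ∀ q → ∣ q ∣ <ʳ 1ʳ → ∀ n → poch q q n #0
poch-#0 q ∣q∣<1 n = product-#0 (λ (j : Fin n) → 1# - q * q ^ toℕ j)
  (λ j → 1-z#0 (q * q ^ toℕ j) (normSq-*^-< q (toℕ j) (√<1⇒<1 (normSq q) ∣q∣<1)))

module QSeries (q : ℂ) (0<∣q∣ : 0ʳ <ʳ ∣ q ∣) (∣q∣<1 : ∣ q ∣ <ʳ 1ʳ) where

  q^_ : ℤ → ℂ
  q^_ = power q (0<∣-∣⇒#0 q 0<∣q∣)

  -- The denominator is inverted using the fact that 1 - q^j is apart from 0
  -- for j ≥ 1; outside 0 ≤ k ≤ n the coefficient is set to 0.
  qBinom : ℕ → ℤ → ℂ
  qBinom n ℤ.-[1+ _ ] = 0#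
  qBinom n (ℤ.+ k) with k ℕ.≤? n
  ... | no _  = 0#
  ... | yes _ = poch q q n * (poch q q k * poch q q l)
                  ⁻¹[ *-#0 {poch q q k} {poch q q l} (poch-#0 q ∣q∣<1 k) (poch-#0 q ∣q∣<1 l) ]
    where l = n ℕ.∸ k

{-# OPTIONS --safe #-}

-- Bailey chain relative to a = 1, with v n = 1/(q;q)ₙ: if
-- β n = Σ_{k≤n} α k v(n-k) v(n+k), then replacing α k by q^(k²) α k replaces
-- β n by Σ_{s≤n} q^(s²) v(n-s) β s.  Take the α of the unit pair, for which
-- β n = 0 unless n = 0.  One step turns β into v and a second one turns it
-- into the sum on the right-hand side divided by (q;q)ₙ.  Meanwhile α has become
-- q^(2k²) α k, which collects the summands for k and -k on the left.

module Submission where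

open import Algebra.Bundles using (CommutativeRing)
open import Data.Fin.Base as Fin using (Fin; toℕ)
import Data.Fin.Properties as Fin
open import Data.Integer.Base as ℤ using (ℤ; +_; -[1+_]; _⊖_)
import Data.Integer.Properties as ℤ
open import Data.Nat.Base as ℕ using (ℕ; zero; suc; z≤n; s≤s)
import Data.Nat.DivMod as ℕ
import Data.Nat.Properties as ℕ
open import Data.Nat.Tactic.RingSolver using (solve-∀)
open import Relation.Binary.PropositionalEquality as ≡ using (_≡_; cong; cong₂)
open import Relation.Nullary using (yes; no; contradiction)

-- Sums over initial segments, change of summation order, folding of symmetric sums.

module FiniteSums {c ℓ} (R : CommutativeRing c ℓ) where
  open CommutativeRing R
  open import Algebra.Properties.Semiring.Sum semiring
  open import Relation.Binary.Reasoning.Setoid setoid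

  Σ< : ℕ → (ℕ → Carrier) → Carrier
  Σ< n f = sum {n} (λ i → f (toℕ i))

  Σ<-cong : ∀ n {f g} → (∀ k → k ℕ.< n → f k ≈ g k) → Σ< n f ≈ Σ< n g
  Σ<-cong n h = sum-cong-≋ {n} (λ i → h (toℕ i) (Fin.toℕ<n i))

  Σ<-last : ∀ n (f : ℕ → Carrier) → Σ< (suc n) f ≈ Σ< n f + f n
  Σ<-last n f = begin
    Σ< (suc n) f
      ≈⟨ sum-init-last {n} (λ i → f (toℕ i)) ⟩
    sum {n} (λ i → f (toℕ (Fin.inject₁ i))) + f (toℕ (Fin.fromℕ n))
      ≡⟨ cong₂ _+_ (sum-cong-≗ {n} (λ i → cong f (Fin.toℕ-inject₁ i))) (cong f (Fin.toℕ-fromℕ n)) ⟩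
    Σ< n f + f n ∎

  Σ<-distrib-+ : ∀ n (f g : ℕ → Carrier) → Σ< n (λ k → f k + g k) ≈ Σ< n f + Σ< n g
  Σ<-distrib-+ n f g = ∑-distrib-+ {n} (λ i → f (toℕ i)) (λ i → g (toℕ i))

  *-distribˡ-Σ< : ∀ n x (f : ℕ → Carrier) → x * Σ< n f ≈ Σ< n (λ k → x * f k)
  *-distribˡ-Σ< n x f = *-distribˡ-sum {n} x (λ i → f (toℕ i))

  Σ<-zero : ∀ n {f} → (∀ k → f k ≈ 0#) → Σ< n f ≈ 0#
  Σ<-zero n h = trans (sum-cong-≋ {n} (λ i → h (toℕ i))) (sum-replicate-zero n)

  -- Both sides run over the pairs with k + j < n, where s = k + j. The induction splits off k = 0
  -- from every inner sum; what is left at s = 0 is empty, so the rest is the statement for n with k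
  -- shifted by one.
  Σ<-triangle : ∀ n (g : ℕ → ℕ → Carrier) →
    Σ< n (λ s → Σ< (suc s) (λ k → g k (s ℕ.∸ k))) ≈ Σ< n (λ k → Σ< (n ℕ.∸ k) (g k))
  Σ<-triangle zero    g = refl
  Σ<-triangle (suc n) g = begin
    Σ< (suc n) (λ s → g 0 s + Σ< s (λ k → g (suc k) (s ℕ.∸ suc k)))
      ≈⟨ Σ<-distrib-+ (suc n) (g 0) (λ s → Σ< s (λ k → g (suc k) (s ℕ.∸ suc k))) ⟩
    Σ< (suc n) (g 0) + (0# + Σ< n (λ s → Σ< (suc s) (λ k → g (suc k) (s ℕ.∸ k))))
      ≈⟨ +-congˡ (trans (+-identityˡ _) (Σ<-triangle n (λ k → g (suc k)))) ⟩
    Σ< (suc n) (g 0) + Σ< n (λ k → Σ< (n ℕ.∸ k) (g (suc k))) ∎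

  fold± : (ℤ → Carrier) → ℕ → Carrier
  fold± g zero    = g (+ 0)
  fold± g (suc k) = g (+ suc k) + g -[1+ k ]

  -- Going from n to n + 1 adds only the two outermost terms: index 0 becomes -(n + 1), the last
  -- index becomes n + 1, and those in between form the sum for n.
  Σ<-fold± : ∀ n (g : ℤ → Carrier) →
    Σ< (suc (n ℕ.+ n)) (λ i → g (i ⊖ n)) ≈ Σ< (suc n) (fold± g)
  Σ<-fold± zero    g = refl
  Σ<-fold± (suc n) g = begin
    g -[1+ n ] + Σ< (suc (n ℕ.+ suc n)) (λ i → g (suc i ⊖ suc n))
      ≡⟨ cong (λ m → g -[1+ n ] + Σ< (suc m) (λ i → g (suc i ⊖ suc n))) (ℕ.+-suc n n) ⟩
    g -[1+ n ] + Σ< (suc (suc (n ℕ.+ n))) (λ i → g (suc i ⊖ suc n))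
      ≈⟨ +-congˡ (Σ<-cong (suc (suc (n ℕ.+ n))) (λ i _ → reflexive (cong g (ℤ.[1+m]⊖[1+n]≡m⊖n i n)))) ⟩
    g -[1+ n ] + Σ< (suc (suc (n ℕ.+ n))) (λ i → g (i ⊖ n))
      ≈⟨ +-congˡ (Σ<-last (suc (n ℕ.+ n)) (λ i → g (i ⊖ n))) ⟩
    g -[1+ n ] + (Σ< (suc (n ℕ.+ n)) (λ i → g (i ⊖ n)) + g (suc (n ℕ.+ n) ⊖ n))
      ≈⟨ +-congˡ (+-cong (Σ<-fold± n g) (reflexive (cong g top))) ⟩
    g -[1+ n ] + (Σ< (suc n) (fold± g) + g (+ suc n))
      ≈⟨ +-comm _ _ ⟩
    Σ< (suc n) (fold± g) + g (+ suc n) + g -[1+ n ]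
      ≈⟨ +-assoc _ _ _ ⟩
    Σ< (suc n) (fold± g) + fold± g (suc n)
      ≈⟨ Σ<-last (suc n) (fold± g) ⟨
    Σ< (suc (suc n)) (fold± g) ∎
    where
    top : suc (n ℕ.+ n) ⊖ n ≡ + suc n
    top = ≡.trans (ℤ.⊖-≥ (ℕ.m≤n+m n (suc n))) (cong +_ (ℕ.m+n∸n≡m (suc n) n))

-- Uniqueness of inverses.

module Inverses {c ℓ} (R : CommutativeRing c ℓ) where
  open CommutativeRing R
  open import Algebra.Properties.CommutativeSemigroup *-commutativeSemigroup using (interchange)
  open import Algebra.Properties.Group +-group using (⁻¹-involutive)
  open import Algebra.Properties.Ring ring using (-1*x≈-x)
  open import Algebra.Properties.Semiring.Exp semiring using (_^_; ^-congˡ)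
  open import Relation.Binary.Reasoning.Setoid setoid

  inverse-unique : ∀ x y z → x * y ≈ 1# → x * z ≈ 1# → y ≈ z
  inverse-unique x y z xy xz = begin
    y              ≈⟨ *-identityʳ y ⟨
    y * 1#         ≈⟨ *-congˡ xz ⟨
    y * (x * z)    ≈⟨ *-assoc y x z ⟨
    y * x * z      ≈⟨ *-congʳ (trans (*-comm y x) xy) ⟩
    1# * z         ≈⟨ *-identityˡ z ⟩
    z              ∎

  inverse-* : ∀ x y x⁻¹ y⁻¹ [xy]⁻¹ → x * x⁻¹ ≈ 1# → y * y⁻¹ ≈ 1# → x * y * [xy]⁻¹ ≈ 1# →
    [xy]⁻¹ ≈ x⁻¹ * y⁻¹
  inverse-* x y x⁻¹ y⁻¹ [xy]⁻¹ hx hy hxy = inverse-unique (x * y) [xy]⁻¹ (x⁻¹ * y⁻¹) hxy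
    (trans (interchange x y x⁻¹ y⁻¹) (trans (*-cong hx hy) (*-identityˡ 1#)))

  -- For signs at negative indices, which are powers of an inverse of -1: that inverse is -1 itself.
  -1-inverse-^ : ∀ x → - 1# * x ≈ 1# → ∀ n → x ^ n ≈ (- 1#) ^ n
  -1-inverse-^ x h n = ^-congˡ n (inverse-unique (- 1#) x (- 1#) h
    (trans (-1*x≈-x (- 1#)) (⁻¹-involutive 1#)))

-- Triangular numbers and the exponent (5k - 1)k/2.

tri : ℕ → ℕ
tri zero    = 0
tri (suc n) = suc n ℕ.+ tri n

tri-*2 : ∀ k → tri k ℕ.* 2 ≡ k ℕ.* suc k
tri-*2 zero    = ≡.refl
tri-*2 (suc k) = ≡.trans (ℕ.*-distribʳ-+ 2 (suc k) (tri k))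
  (≡.trans (cong (suc k ℕ.* 2 ℕ.+_) (tri-*2 k)) (lem k))
  where
  lem : ∀ k → suc k ℕ.* 2 ℕ.+ k ℕ.* suc k ≡ suc k ℕ.* suc (suc k)
  lem = solve-∀

exponent : ℤ → ℤ
exponent k = ((+ 5 ℤ.* k ℤ.- + 1) ℤ.* k) ℤ./ + 2

m*2/2 : ∀ {i} m → i ≡ + (m ℕ.* 2) → i ℤ./ + 2 ≡ + m
m*2/2 m ≡.refl = ≡.trans (ℤ.*-identityˡ _) (cong +_ (ℕ.m*n/n≡m m 2))

double-exponent : ∀ {m l t} k → m ≡ l ℕ.+ 4 ℕ.* (suc k ℕ.* suc k) → t ℕ.* 2 ≡ l →
  m ≡ (suc k ℕ.* suc k ℕ.+ (suc k ℕ.* suc k ℕ.+ t)) ℕ.* 2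
double-exponent {t = t} k ≡.refl ≡.refl = lem k t
  where
  lem : ∀ k t → t ℕ.* 2 ℕ.+ 4 ℕ.* (suc k ℕ.* suc k)
              ≡ (suc k ℕ.* suc k ℕ.+ (suc k ℕ.* suc k ℕ.+ t)) ℕ.* 2
  lem = solve-∀

-- With K = k + 1, the numerator is 4K² + K(K - 1) at K and 4K² + K(K + 1) at -K, and half of the
-- last summand is triangular. The two copies of K² match the two steps of the Bailey chain; the
-- triangular number is the exponent in `α`.
exponent-pos : ∀ k → exponent (+ suc k) ≡ + (suc k ℕ.* suc k ℕ.+ (suc k ℕ.* suc k ℕ.+ tri k))
exponent-pos k = m*2/2 _ (≡.trans (ℤ.+◃n≡+n _) (cong +_ (double-exponent k (lem k) (tri-*2 k))))
  where
  lem : ∀ k → (k ℕ.+ 4 ℕ.* suc k) ℕ.* suc k ≡ k ℕ.* suc k ℕ.+ 4 ℕ.* (suc k ℕ.* suc k)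
  lem = solve-∀

exponent-neg : ∀ k → exponent -[1+ k ] ≡ + (suc k ℕ.* suc k ℕ.+ (suc k ℕ.* suc k ℕ.+ tri (suc k)))
exponent-neg k = m*2/2 _ (cong +_ (double-exponent k (lem k) (tri-*2 (suc k))))
  where
  lem : ∀ k → suc (suc (k ℕ.+ 4 ℕ.* suc k ℕ.+ 0)) ℕ.* suc k
            ≡ suc k ℕ.* suc (suc k) ℕ.+ 4 ℕ.* (suc k ℕ.* suc k)
  lem = solve-∀

-- The Bailey chain over a commutative ring, with `u n` for (q;q)ₙ and `v n` for its inverse.

module BaileyPairs {c ℓ} (R : CommutativeRing c ℓ) (q : CommutativeRing.Carrier R)
  (u v : ℕ → CommutativeRing.Carrier R) where
  open CommutativeRing R
  open import Algebra.Properties.Ring ring using (x[y-z]≈xy-xz; -1*x≈-x)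
  open import Algebra.Properties.Semiring.Exp semiring using (_^_; ^-homo-*)
  open import Algebra.Solver.Ring.NaturalCoefficients.Default commutativeSemiring
    using (solve; con; _:=_; _:+_; _:*_)
  open import Relation.Binary.Reasoning.Setoid setoid
  open FiniteSums R

  p : ℕ → Carrier
  p n = 1# - q ^ n

  q^-cong : ∀ {m n} → m ≡ n → q ^ m ≈ q ^ n
  q^-cong e = reflexive (cong (q ^_) e)

  v-cong : ∀ {m n} → m ≡ n → v m ≈ v n
  v-cong e = reflexive (cong v e)

  p-zero : p 0 ≈ 0#
  p-zero = -‿inverseʳ 1#

  p+q^ : ∀ n → p n + q ^ n ≈ 1#
  p+q^ n = trans (+-assoc _ _ _) (trans (+-congˡ (-‿inverseˡ _)) (+-identityʳ _))

  -- Telescoping of 1 - q^m + q^m - q^(m+n). The q-Pascal rule and the recurrences for `α` all come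
  -- from this splitting.
  p-+ : ∀ m n → p (m ℕ.+ n) ≈ p m + q ^ m * p n
  p-+ m n = sym (begin
    p m + q ^ m * p n                           ≈⟨ +-congˡ (x[y-z]≈xy-xz _ _ _) ⟩
    p m + (q ^ m * 1# - q ^ m * q ^ n)          ≈⟨ +-congˡ (+-cong (*-identityʳ _) (-‿cong (sym (^-homo-* q m n)))) ⟩
    p m + (q ^ m - q ^ (m ℕ.+ n))               ≈⟨ +-assoc _ _ _ ⟨
    p m + q ^ m - q ^ (m ℕ.+ n)                 ≈⟨ +-congʳ (p+q^ m) ⟩
    p (m ℕ.+ n)                                 ∎)

  sgn : ℕ → Carrier
  sgn k = (- 1#) ^ k

  sgn-suc : ∀ k → sgn k + sgn (suc k) ≈ 0#
  sgn-suc k = trans (+-congˡ (-1*x≈-x _)) (-‿inverseʳ _)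

  -- The summands of index k and -k of the unit Bailey pair, taken together.
  α : ℕ → Carrier
  α zero    = 1#
  α (suc k) = sgn (suc k) * (q ^ tri k + q ^ tri (suc k))

  module _ (u-zero : u 0 ≈ 1#) (u-suc : ∀ n → u (suc n) ≈ u n * p (suc n))
           (u*v : ∀ n → u n * v n ≈ 1#) where

    v-zero : v 0 ≈ 1#
    v-zero = trans (sym (*-identityˡ _)) (trans (*-congʳ (sym u-zero)) (u*v 0))

    v-suc : ∀ n → p (suc n) * v (suc n) ≈ v n
    v-suc n = begin
      p (suc n) * v (suc n)                   ≈⟨ *-identityˡ _ ⟨
      1# * (p (suc n) * v (suc n))            ≈⟨ *-congʳ (u*v n) ⟨
      u n * v n * (p (suc n) * v (suc n))     ≈⟨ solve 4 (λ a b c d → a :* b :* (c :* d) := a :* c :* d :* b) refl _ _ _ _ ⟩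
      u n * p (suc n) * v (suc n) * v n       ≈⟨ *-congʳ (*-congʳ (u-suc n)) ⟨
      u (suc n) * v (suc n) * v n             ≈⟨ *-congʳ (u*v (suc n)) ⟩
      1# * v n                                ≈⟨ *-identityˡ _ ⟩
      v n                                     ∎

    -- `u n * v (suc n)` is an inverse of 1 - q^(n+1).
    p-cancel : ∀ n {x y} → p (suc n) * x ≈ p (suc n) * y → x ≈ y
    p-cancel n {x} {y} h = trans (sym (invert x)) (trans (*-congˡ h) (invert y))
      where
      invert : ∀ z → u n * v (suc n) * (p (suc n) * z) ≈ z
      invert z = begin
        u n * v (suc n) * (p (suc n) * z)     ≈⟨ solve 4 (λ a b c d → a :* b :* (c :* d) := a :* c :* b :* d) refl _ _ _ _ ⟩
        u n * p (suc n) * v (suc n) * z       ≈⟨ *-congʳ (*-congʳ (u-suc n)) ⟨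
        u (suc n) * v (suc n) * z             ≈⟨ *-congʳ (u*v (suc n)) ⟩
        1# * z                                ≈⟨ *-identityˡ z ⟩
        z                                     ∎

    -- The q-Pascal rule summed against w, since v j v(M-j) is the q-binomial
    -- coefficient divided by (q;q)_M.
    pascal : ∀ M (w : ℕ → Carrier) →
      p (suc M) * Σ< (suc (suc M)) (λ j → v j * v (suc M ℕ.∸ j) * w j)
      ≈ Σ< (suc M) (λ j → v j * v (M ℕ.∸ j) * (q ^ j * w j + w (suc j)))
    pascal M w = begin
      p (suc M) * Σ< (suc (suc M)) (λ j → v j * v (suc M ℕ.∸ j) * w j)
        ≈⟨ *-distribˡ-Σ< (suc (suc M)) _ (λ j → v j * v (suc M ℕ.∸ j) * w j) ⟩
      Σ< (suc (suc M)) (λ j → p (suc M) * (v j * v (suc M ℕ.∸ j) * w j))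
        -- Since M + 1 = j + (M + 1 - j), `p-+` splits `p (suc M)`. The part `p j` lowers `v j` and
        -- gives `B`, the other lowers `v (suc M ∸ j)` and gives `A`. As `p 0` vanishes, so do `A`
        -- at M + 1 and `B` at 0.
        ≈⟨ Σ<-cong (suc (suc M)) split ⟩
      Σ< (suc (suc M)) (λ j → A j + B j)
        ≈⟨ Σ<-distrib-+ (suc (suc M)) A B ⟩
      Σ< (suc (suc M)) A + Σ< (suc (suc M)) B
        ≈⟨ +-cong (trans (Σ<-last (suc M) A) (+-congˡ A-last)) (+-congʳ B-first) ⟩
      Σ< (suc M) A + 0# + (0# + Σ< (suc M) (λ j → B (suc j)))
        ≈⟨ +-cong (+-identityʳ _) (+-identityˡ _) ⟩
      Σ< (suc M) A + Σ< (suc M) (λ j → B (suc j))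
        ≈⟨ Σ<-distrib-+ (suc M) A (λ j → B (suc j)) ⟨
      Σ< (suc M) (λ j → A j + B (suc j))
        ≈⟨ Σ<-cong (suc M) merge ⟩
      Σ< (suc M) (λ j → v j * v (M ℕ.∸ j) * (q ^ j * w j + w (suc j))) ∎
      where
      A B : ℕ → Carrier
      A j = v j * (p (suc M ℕ.∸ j) * v (suc M ℕ.∸ j)) * (q ^ j * w j)
      B j = p j * v j * v (suc M ℕ.∸ j) * w j
      split : ∀ j → j ℕ.< suc (suc M) → p (suc M) * (v j * v (suc M ℕ.∸ j) * w j) ≈ A j + B j
      split j (s≤s j≤) = trans
        (*-congʳ (trans (reflexive (cong p (≡.sym (ℕ.m+[n∸m]≡n j≤)))) (p-+ j (suc M ℕ.∸ j))))
        (solve 6 (λ a b x y z w → (a :+ x :* b) :* (y :* z :* w)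
            := y :* (b :* z) :* (x :* w) :+ a :* y :* z :* w)
          refl (p j) (p (suc M ℕ.∸ j)) (q ^ j) (v j) (v (suc M ℕ.∸ j)) (w j))
      A-last : A (suc M) ≈ 0#
      A-last = trans (*-congʳ (*-congˡ (trans
          (*-congʳ (trans (reflexive (cong p (ℕ.n∸n≡0 (suc M)))) p-zero)) (zeroˡ _))))
        (trans (*-congʳ (zeroʳ _)) (zeroˡ _))
      B-first : B 0 ≈ 0#
      B-first = trans (*-congʳ (*-congʳ (trans (*-congʳ p-zero) (zeroˡ _))))
        (trans (*-congʳ (zeroˡ _)) (zeroˡ _))
      merge : ∀ j → j ℕ.< suc M → A j + B (suc j) ≈ v j * v (M ℕ.∸ j) * (q ^ j * w j + w (suc j))
      merge j (s≤s j≤M) = trans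
        (+-cong
          (*-congʳ (*-congˡ (trans (reflexive (cong (λ k → p k * v k) (ℕ.+-∸-assoc 1 j≤M))) (v-suc (M ℕ.∸ j)))))
          (*-congʳ (*-congʳ (v-suc j))))
        (sym (distribˡ _ _ _))

    -- A limiting case of the q-Chu-Vandermonde sum. The induction on M leaves c free: after the
    -- q-Pascal rule, neighbouring weights for c merge into one weight for c + 1.
    vandermonde : ∀ M c →
      Σ< (suc M) (λ j → v j * v (M ℕ.∸ j) * (q ^ (j ℕ.* (j ℕ.+ c)) * v (j ℕ.+ c))) ≈ v M * v (M ℕ.+ c)
    vandermonde zero c = begin
      v 0 * v 0 * (1# * v c) + 0#   ≈⟨ +-identityʳ _ ⟩
      v 0 * v 0 * (1# * v c)        ≈⟨ *-cong (*-congʳ v-zero) (*-identityˡ _) ⟩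
      1# * v 0 * v c                ≈⟨ *-congʳ (*-identityˡ _) ⟩
      v 0 * v c                     ∎
    vandermonde (suc M) c = p-cancel M (begin
      p (suc M) * Σ< (suc (suc M)) (λ j → v j * v (suc M ℕ.∸ j) * w j)
        ≈⟨ pascal M w ⟩
      Σ< (suc M) (λ j → v j * v (M ℕ.∸ j) * (q ^ j * w j + w (suc j)))
        ≈⟨ Σ<-cong (suc M) (λ j _ → *-congˡ {v j * v (M ℕ.∸ j)} (step j)) ⟩
      Σ< (suc M) (λ j → v j * v (M ℕ.∸ j) * (q ^ (j ℕ.* (j ℕ.+ suc c)) * v (j ℕ.+ suc c)))
        ≈⟨ vandermonde M (suc c) ⟩
      v M * v (M ℕ.+ suc c)
        ≈⟨ *-cong (sym (v-suc M)) (v-cong (ℕ.+-suc M c)) ⟩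
      p (suc M) * v (suc M) * v (suc M ℕ.+ c)
        ≈⟨ *-assoc _ _ _ ⟩
      p (suc M) * (v (suc M) * v (suc M ℕ.+ c)) ∎)
      where
      w : ℕ → Carrier
      w j = q ^ (j ℕ.* (j ℕ.+ c)) * v (j ℕ.+ c)
      exponent₁ : ∀ j c → j ℕ.+ j ℕ.* (j ℕ.+ c) ≡ j ℕ.* (j ℕ.+ suc c)
      exponent₁ = solve-∀
      exponent₂ : ∀ j c → suc j ℕ.* suc (j ℕ.+ c) ≡ j ℕ.* (j ℕ.+ suc c) ℕ.+ suc (j ℕ.+ c)
      exponent₂ = solve-∀
      step : ∀ j → q ^ j * w j + w (suc j) ≈ q ^ (j ℕ.* (j ℕ.+ suc c)) * v (j ℕ.+ suc c)
      step j = begin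
        q ^ j * (q ^ (j ℕ.* (j ℕ.+ c)) * v (j ℕ.+ c)) + q ^ (suc j ℕ.* suc (j ℕ.+ c)) * V
          -- Both terms become multiples of `Q * V`, with coefficients 1 - q^(j+c+1) and q^(j+c+1),
          -- which add up to 1.
          ≈⟨ +-cong (trans (sym (*-assoc _ _ _)) (*-cong
                (trans (sym (^-homo-* q j _)) (q^-cong (exponent₁ j c)))
                (sym (v-suc (j ℕ.+ c)))))
              (*-congʳ (trans (q^-cong (exponent₂ j c))
                (^-homo-* q (j ℕ.* (j ℕ.+ suc c)) _))) ⟩
        Q * (p (suc (j ℕ.+ c)) * V) + Q * q ^ suc (j ℕ.+ c) * V
          ≈⟨ solve 4 (λ a b x V → a :* (b :* V) :+ a :* x :* V := a :* ((b :+ x) :* V)) refl Q _ _ V ⟩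
        Q * ((p (suc (j ℕ.+ c)) + q ^ suc (j ℕ.+ c)) * V)
          ≈⟨ *-congˡ (trans (*-congʳ (p+q^ (suc (j ℕ.+ c)))) (*-identityˡ _)) ⟩
        Q * V
          ≈⟨ *-congˡ (v-cong (≡.sym (ℕ.+-suc j c))) ⟩
        Q * v (j ℕ.+ suc c) ∎
        where
        Q = q ^ (j ℕ.* (j ℕ.+ suc c))
        V = v (suc (j ℕ.+ c))

    -- Bailey's lemma with both parameters sent to infinity. Put s = k + j and sum over j first: as
    -- (k + j)² = k² + j(j + 2k), the inner sum is `vandermonde` with M = N - k and c = 2k.
    bailey : ∀ (a : ℕ → Carrier) N →
      Σ< (suc N) (λ s → q ^ (s ℕ.* s) * v (N ℕ.∸ s) * Σ< (suc s) (λ k → a k * (v (s ℕ.∸ k) * v (s ℕ.+ k))))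
      ≈ Σ< (suc N) (λ k → q ^ (k ℕ.* k) * a k * (v (N ℕ.∸ k) * v (N ℕ.+ k)))
    bailey a N = begin
      Σ< (suc N) (λ s → q ^ (s ℕ.* s) * v (N ℕ.∸ s) * Σ< (suc s) (λ k → a k * (v (s ℕ.∸ k) * v (s ℕ.+ k))))
        ≈⟨ Σ<-cong (suc N) (λ s _ → trans
             (*-distribˡ-Σ< (suc s) _ (λ k → a k * (v (s ℕ.∸ k) * v (s ℕ.+ k))))
             (Σ<-cong (suc s) (expand s))) ⟩
      Σ< (suc N) (λ s → Σ< (suc s) (λ k → g k (s ℕ.∸ k)))
        ≈⟨ Σ<-triangle (suc N) g ⟩
      Σ< (suc N) (λ k → Σ< (suc N ℕ.∸ k) (g k))
        ≈⟨ Σ<-cong (suc N) collect ⟩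
      Σ< (suc N) (λ k → q ^ (k ℕ.* k) * a k * (v (N ℕ.∸ k) * v (N ℕ.+ k))) ∎
      where
      g : ℕ → ℕ → Carrier
      g k j = q ^ ((k ℕ.+ j) ℕ.* (k ℕ.+ j)) * v (N ℕ.∸ (k ℕ.+ j)) * (a k * (v j * v (k ℕ.+ j ℕ.+ k)))
      square : ∀ j k → (k ℕ.+ j) ℕ.* (k ℕ.+ j) ≡ k ℕ.* k ℕ.+ j ℕ.* (j ℕ.+ (k ℕ.+ k))
      square = solve-∀
      index : ∀ j k → k ℕ.+ j ℕ.+ k ≡ j ℕ.+ (k ℕ.+ k)
      index = solve-∀
      expand : ∀ s k → k ℕ.< suc s →
        q ^ (s ℕ.* s) * v (N ℕ.∸ s) * (a k * (v (s ℕ.∸ k) * v (s ℕ.+ k))) ≈ g k (s ℕ.∸ k)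
      expand s k (s≤s k≤s) = reflexive (cong
        (λ t → q ^ (t ℕ.* t) * v (N ℕ.∸ t) * (a k * (v (s ℕ.∸ k) * v (t ℕ.+ k))))
        (≡.sym (ℕ.m+[n∸m]≡n k≤s)))
      collect : ∀ k → k ℕ.< suc N →
        Σ< (suc N ℕ.∸ k) (g k) ≈ q ^ (k ℕ.* k) * a k * (v (N ℕ.∸ k) * v (N ℕ.+ k))
      collect k (s≤s k≤N) = begin
        Σ< (suc N ℕ.∸ k) (g k)
          ≡⟨ cong (λ m → Σ< m (g k)) (ℕ.+-∸-assoc 1 k≤N) ⟩
        Σ< (suc M) (g k)
          ≈⟨ Σ<-cong (suc M) (λ j _ → term j) ⟩
        Σ< (suc M) (λ j → q ^ (k ℕ.* k) * a k * h j)
          ≈⟨ *-distribˡ-Σ< (suc M) _ h ⟨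
        q ^ (k ℕ.* k) * a k * Σ< (suc M) h
          ≈⟨ *-congˡ (vandermonde M (k ℕ.+ k)) ⟩
        q ^ (k ℕ.* k) * a k * (v M * v (M ℕ.+ (k ℕ.+ k)))
          ≈⟨ *-congˡ (*-congˡ (v-cong (≡.trans (≡.sym (ℕ.+-assoc M k k)) (cong (ℕ._+ k) (ℕ.m∸n+n≡m k≤N))))) ⟩
        q ^ (k ℕ.* k) * a k * (v M * v (N ℕ.+ k)) ∎
        where
        M = N ℕ.∸ k
        h : ℕ → Carrier
        h j = v j * v (M ℕ.∸ j) * (q ^ (j ℕ.* (j ℕ.+ (k ℕ.+ k))) * v (j ℕ.+ (k ℕ.+ k)))
        term : ∀ j → g k j ≈ q ^ (k ℕ.* k) * a k * h j
        term j = trans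
          (*-cong
            (*-cong
              (trans (q^-cong (square j k))
                (^-homo-* q (k ℕ.* k) _))
              (v-cong (≡.sym (ℕ.∸-+-assoc N k j))))
            (*-congˡ (*-congˡ (v-cong (index j k)))))
          (solve 6 (λ x y m a j w → x :* y :* m :* (a :* (j :* w)) := x :* a :* (j :* m :* (y :* w)))
            refl _ _ _ _ _ _)

    -- Prepares a telescoping at fixed n: by `v-suc` and `sgn-suc`, the second summand cancels the
    -- first summand for K + 1 and m - 1. For m = 0 it vanishes because of `p 0`.
    α-term : ∀ m K → let n = suc K ℕ.+ m in
      p n * (α (suc K) * (v m * v (n ℕ.+ suc K)))
      ≈ sgn (suc K) * q ^ tri K * (v m * v (n ℕ.+ K))
        + sgn (suc K) * q ^ tri (suc K) * (p m * v m * v (n ℕ.+ suc K))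
    α-term m K = begin
      p n * (e * (t + q ^ tri (suc K)) * (v m * V))
        ≈⟨ *-cong (p-+ (suc K) m) (*-congʳ (*-congˡ (+-congˡ t′))) ⟩
      (a + x * b) * (e * (t + x * t) * (v m * V))
        -- This is p n (1 + q^(K+1)) = p (n+K+1) + q^(K+1) p m, with p (n+K+1) still in the form
        -- `a + x * (a + x * b)`.
        ≈⟨ solve 7 (λ a x b e t w V → (a :+ x :* b) :* (e :* (t :+ x :* t) :* (w :* V))
             := e :* t :* (w :* ((a :+ x :* (a :+ x :* b)) :* V)) :+ e :* (x :* t) :* (b :* w :* V))
           refl a x b e t (v m) V ⟩
      e * t * (v m * ((a + x * (a + x * b)) * V)) + e * (x * t) * (b * v m * V)
        ≈⟨ +-cong (*-congˡ (*-congˡ V-step)) (*-congʳ (*-congˡ (sym t′))) ⟩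
      e * t * (v m * v (n ℕ.+ K)) + e * q ^ tri (suc K) * (b * v m * V) ∎
      where
      n = suc K ℕ.+ m
      a = p (suc K)
      b = p m
      x = q ^ suc K
      e = sgn (suc K)
      t = q ^ tri K
      V = v (n ℕ.+ suc K)
      t′ : q ^ tri (suc K) ≈ x * t
      t′ = ^-homo-* q (suc K) (tri K)
      V-step : (a + x * (a + x * b)) * V ≈ v (n ℕ.+ K)
      V-step = begin
        (a + x * (a + x * b)) * V                     ≈⟨ *-congʳ (+-congˡ (*-congˡ (p-+ (suc K) m))) ⟨
        (a + x * p n) * V                             ≈⟨ *-congʳ (p-+ (suc K) n) ⟨
        p (suc K ℕ.+ n) * V                           ≡⟨ cong₂ (λ i j → p i * v j)
                                                           (≡.trans (ℕ.+-comm (suc K) n) (ℕ.+-suc n K)) (ℕ.+-suc n K) ⟩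
        p (suc (n ℕ.+ K)) * v (suc (n ℕ.+ K))         ≈⟨ v-suc (n ℕ.+ K) ⟩
        v (n ℕ.+ K)                                   ∎

    -- The sum is the part with indices K + 1 to n of the sum defining β n. Multiplied by `p n` it
    -- telescopes by `α-term`, leaving only the first boundary term. The induction shortens the tail
    -- from the front, so the call at K + 1 concerns the same n up to `+-suc`.
    α-tail : ∀ m K → let n = suc K ℕ.+ m in
      p n * Σ< (suc m) (λ j → α (suc (K ℕ.+ j)) * (v (m ℕ.∸ j) * v (n ℕ.+ suc (K ℕ.+ j))))
      ≈ sgn (suc K) * q ^ tri K * (v m * v (n ℕ.+ K))
    α-tail zero K = begin
      p n * (α (suc (K ℕ.+ 0)) * (v 0 * v (n ℕ.+ suc (K ℕ.+ 0))) + 0#)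
        ≈⟨ *-congˡ (+-identityʳ _) ⟩
      p n * (α (suc (K ℕ.+ 0)) * (v 0 * v (n ℕ.+ suc (K ℕ.+ 0))))
        ≡⟨ cong (λ k → p n * (α (suc k) * (v 0 * v (n ℕ.+ suc k)))) (ℕ.+-identityʳ K) ⟩
      p n * (α (suc K) * (v 0 * v (n ℕ.+ suc K)))
        ≈⟨ α-term 0 K ⟩
      sgn (suc K) * q ^ tri K * (v 0 * v (n ℕ.+ K))
        + sgn (suc K) * q ^ tri (suc K) * (p 0 * v 0 * v (n ℕ.+ suc K))
        ≈⟨ +-congˡ (trans (*-congˡ (trans (*-congʳ (trans (*-congʳ p-zero) (zeroˡ _))) (zeroˡ _))) (zeroʳ _)) ⟩
      sgn (suc K) * q ^ tri K * (v 0 * v (n ℕ.+ K)) + 0#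
        ≈⟨ +-identityʳ _ ⟩
      sgn (suc K) * q ^ tri K * (v 0 * v (n ℕ.+ K)) ∎
      where n = suc K ℕ.+ 0
    α-tail (suc m) K = begin
      p n * (f K′ 0 + Σ< (suc m) (λ j → f (K ℕ.+ suc j) (suc j)))
        ≈⟨ distribˡ _ _ _ ⟩
      p n * f K′ 0 + p n * Σ< (suc m) (λ j → f (K ℕ.+ suc j) (suc j))
        ≈⟨ +-cong
             (trans (reflexive (cong (λ k → p n * f k 0) (ℕ.+-identityʳ K))) (α-term (suc m) K))
             (trans (*-congˡ (Σ<-cong (suc m) (λ j _ → reflexive (cong (λ k → f k (suc j)) (ℕ.+-suc K j)))))
               (trans (reflexive (cong
                   (λ i → p i * Σ< (suc m) (λ j → α (suc (suc K ℕ.+ j)) * (v (m ℕ.∸ j) * v (i ℕ.+ suc (suc K ℕ.+ j)))))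
                   (ℕ.+-suc (suc K) m)))
                 (α-tail m (suc K)))) ⟩
      e * t * (v (suc m) * v (n ℕ.+ K)) + e * t′ * (p (suc m) * v (suc m) * V)
        + sgn (suc (suc K)) * t′ * (v m * v (suc (suc K) ℕ.+ m ℕ.+ suc K))
        ≈⟨ +-cong (+-congˡ (*-congˡ (*-congʳ (v-suc m))))
             (*-congˡ (*-congˡ (v-cong (cong (ℕ._+ suc K) (≡.sym (ℕ.+-suc (suc K) m)))))) ⟩
      X + e * t′ * (v m * V) + sgn (suc (suc K)) * t′ * (v m * V)
        ≈⟨ solve 5 (λ X e e′ t w → X :+ e :* t :* w :+ e′ :* t :* w := X :+ (e :+ e′) :* (t :* w))
             refl X e (sgn (suc (suc K))) t′ (v m * V) ⟩
      X + (e + sgn (suc (suc K))) * (t′ * (v m * V))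
        ≈⟨ +-congˡ (trans (*-congʳ (sgn-suc (suc K))) (zeroˡ _)) ⟩
      X + 0#
        ≈⟨ +-identityʳ X ⟩
      X ∎
      where
      n  = suc K ℕ.+ suc m
      K′ = K ℕ.+ 0
      e  = sgn (suc K)
      t  = q ^ tri K
      t′ = q ^ tri (suc K)
      V  = v (n ℕ.+ suc K)
      X  = e * t * (v (suc m) * v (n ℕ.+ K))
      f : ℕ → ℕ → Carrier
      f k j = α (suc k) * (v (suc m ℕ.∸ j) * v (n ℕ.+ suc k))

    -- After multiplication by `p (suc m)`, the summand at 0 becomes `v m * V`, and `α-tail` with K
    -- = 0 turns all the others into its negative.
    unit-pair : ∀ m → Σ< (suc (suc m)) (λ k → α k * (v (suc m ℕ.∸ k) * v (suc m ℕ.+ k))) ≈ 0#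
    unit-pair m = p-cancel m (begin
      p (suc m) * (1# * (v (suc m) * V) + S)
        ≈⟨ distribˡ _ _ _ ⟩
      p (suc m) * (1# * (v (suc m) * V)) + p (suc m) * S
        ≈⟨ +-cong (trans (*-congˡ (*-identityˡ _)) (trans (sym (*-assoc _ _ _)) (*-congʳ (v-suc m)))) (α-tail m 0) ⟩
      v m * V + sgn 1 * 1# * (v m * V)
        ≈⟨ solve 2 (λ e w → w :+ e :* con 1 :* w := (con 1 :+ e) :* w) refl (sgn 1) (v m * V) ⟩
      (sgn 0 + sgn 1) * (v m * V)
        ≈⟨ *-congʳ (sgn-suc 0) ⟩
      0# * (v m * V)
        ≈⟨ zeroˡ _ ⟩
      0#
        ≈⟨ zeroʳ _ ⟨
      p (suc m) * 0# ∎)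
      where
      V = v (suc m ℕ.+ 0)
      S = Σ< (suc m) (λ j → α (suc j) * (v (m ℕ.∸ j) * v (suc m ℕ.+ suc j)))

    -- First step of the chain: in `bailey α` only s = 0 survives, by `unit-pair`.
    α-pair : ∀ n → Σ< (suc n) (λ k → q ^ (k ℕ.* k) * α k * (v (n ℕ.∸ k) * v (n ℕ.+ k))) ≈ v n
    α-pair n = begin
      Σ< (suc n) (λ k → q ^ (k ℕ.* k) * α k * (v (n ℕ.∸ k) * v (n ℕ.+ k)))
        ≈⟨ bailey α n ⟨
      1# * v n * (1# * (v 0 * v 0) + 0#)
        + Σ< n (λ s → q ^ (suc s ℕ.* suc s) * v (n ℕ.∸ suc s)
            * Σ< (suc (suc s)) (λ k → α k * (v (suc s ℕ.∸ k) * v (suc s ℕ.+ k))))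
        ≈⟨ +-cong
             (*-cong (*-identityˡ _) (trans (+-identityʳ _) (trans (*-identityˡ _)
               (trans (*-cong v-zero v-zero) (*-identityˡ _)))))
             (Σ<-zero n (λ s → trans (*-congˡ {q ^ (suc s ℕ.* suc s) * v (n ℕ.∸ suc s)} (unit-pair s)) (zeroʳ _))) ⟩
      v n * 1# + 0#
        ≈⟨ trans (+-identityʳ _) (*-identityʳ _) ⟩
      v n ∎

    -- Second step of the chain, with each inner sum evaluated by `α-pair`.
    finite-rogers-ramanujan : ∀ n →
      Σ< (suc n) (λ k → q ^ (k ℕ.* k) * (q ^ (k ℕ.* k) * α k) * (v (n ℕ.∸ k) * v (n ℕ.+ k)))
      ≈ Σ< (suc n) (λ s → q ^ (s ℕ.* s) * v (n ℕ.∸ s) * v s)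
    finite-rogers-ramanujan n = trans
      (sym (bailey (λ k → q ^ (k ℕ.* k) * α k) n))
      (Σ<-cong (suc n) (λ s _ → *-congˡ {q ^ (s ℕ.* s) * v (n ℕ.∸ s)} (α-pair s)))

    -- Translation into q-binomial coefficients and integer powers.

    module _
      (binom : ℕ → ℤ → Carrier)
      (binom-≤ : ∀ n k → k ℕ.≤ n → binom n (+ k) ≈ u n * (v k * v (n ℕ.∸ k)))
      (sgnℤ : ℤ → Carrier) (sgnℤ-pos : ∀ k → sgnℤ (+ k) ≈ sgn k) (sgnℤ-neg : ∀ k → sgnℤ -[1+ k ] ≈ sgn (suc k))
      (pow : ℤ → Carrier) (pow-pos : ∀ k → pow (+ k) ≈ q ^ k) where

      summand : ℕ → ℤ → Carrier
      summand n k = binom (2 ℕ.* n) (+ n ℤ.+ k) * sgnℤ k * pow (exponent k)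

      binom-pos : ∀ n k → k ℕ.≤ n →
        binom (2 ℕ.* n) (+ n ℤ.+ + k) ≈ u (2 ℕ.* n) * (v (n ℕ.∸ k) * v (n ℕ.+ k))
      binom-pos n k k≤n = begin
        binom (2 ℕ.* n) (+ (n ℕ.+ k))
          ≈⟨ binom-≤ (2 ℕ.* n) (n ℕ.+ k) (ℕ.+-monoʳ-≤ n (ℕ.≤-trans k≤n (ℕ.m≤m+n n 0))) ⟩
        u (2 ℕ.* n) * (v (n ℕ.+ k) * v (2 ℕ.* n ℕ.∸ (n ℕ.+ k)))
          ≡⟨ cong (λ m → u (2 ℕ.* n) * (v (n ℕ.+ k) * v m))
               (≡.trans (ℕ.[m+n]∸[m+o]≡n∸o n (n ℕ.+ 0) k) (cong (ℕ._∸ k) (ℕ.+-identityʳ n))) ⟩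
        u (2 ℕ.* n) * (v (n ℕ.+ k) * v (n ℕ.∸ k))
          ≈⟨ *-congˡ (*-comm _ _) ⟩
        u (2 ℕ.* n) * (v (n ℕ.∸ k) * v (n ℕ.+ k)) ∎

      binom-neg : ∀ n k → suc k ℕ.≤ n →
        binom (2 ℕ.* n) (+ n ℤ.+ -[1+ k ]) ≈ u (2 ℕ.* n) * (v (n ℕ.∸ suc k) * v (n ℕ.+ suc k))
      binom-neg n k k<n = begin
        binom (2 ℕ.* n) (n ⊖ suc k)
          ≡⟨ cong (binom (2 ℕ.* n)) (ℤ.⊖-≥ k<n) ⟩
        binom (2 ℕ.* n) (+ (n ℕ.∸ suc k))
          ≈⟨ binom-≤ (2 ℕ.* n) (n ℕ.∸ suc k) (ℕ.≤-trans (ℕ.m∸n≤m n (suc k)) (ℕ.m≤m+n n (n ℕ.+ 0))) ⟩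
        u (2 ℕ.* n) * (v (n ℕ.∸ suc k) * v (2 ℕ.* n ℕ.∸ (n ℕ.∸ suc k)))
          ≡⟨ cong (λ m → u (2 ℕ.* n) * (v (n ℕ.∸ suc k) * v m)) complement ⟩
        u (2 ℕ.* n) * (v (n ℕ.∸ suc k) * v (n ℕ.+ suc k)) ∎
        where
        complement : 2 ℕ.* n ℕ.∸ (n ℕ.∸ suc k) ≡ n ℕ.+ suc k
        complement = ≡.trans (cong (λ m → n ℕ.+ m ℕ.∸ (n ℕ.∸ suc k)) (ℕ.+-identityʳ n))
          (≡.trans (ℕ.+-∸-assoc n (ℕ.m∸n≤m n (suc k))) (cong (n ℕ.+_) (ℕ.m∸[m∸n]≡n k<n)))

      pow-exponent : ∀ {i} s t → i ≡ + (s ℕ.+ (s ℕ.+ t)) → pow i ≈ q ^ s * (q ^ s * q ^ t)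
      pow-exponent s t ≡.refl = trans (pow-pos _)
        (trans (^-homo-* q s (s ℕ.+ t)) (*-congˡ (^-homo-* q s t)))

      -- By the symmetry of the q-binomial coefficient, the summands at k and -k differ only in
      -- their triangular exponents; the sum of these two powers, with the sign, is `α k`.
      fold±-summand : ∀ n k → k ℕ.≤ n → fold± (summand n) k
        ≈ u (2 ℕ.* n) * (q ^ (k ℕ.* k) * (q ^ (k ℕ.* k) * α k) * (v (n ℕ.∸ k) * v (n ℕ.+ k)))
      fold±-summand n zero k≤n = trans
        (*-cong (*-cong (binom-pos n 0 k≤n) (sgnℤ-pos 0)) (pow-pos 0))
        (solve 2 (λ U V → U :* V :* con 1 :* con 1 := U :* (con 1 :* (con 1 :* con 1) :* V)) refl
          (u (2 ℕ.* n)) (v (n ℕ.∸ 0) * v (n ℕ.+ 0)))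
      fold±-summand n (suc k) k<n = trans
        (+-cong
          (*-cong (*-cong (binom-pos n (suc k) k<n) (sgnℤ-pos (suc k)))
            (pow-exponent (suc k ℕ.* suc k) (tri k) (exponent-pos k)))
          (*-cong (*-cong (binom-neg n k k<n) (sgnℤ-neg k))
            (pow-exponent (suc k ℕ.* suc k) (tri (suc k)) (exponent-neg k))))
        (solve 6 (λ U V e Q t t′ →
            U :* V :* e :* (Q :* (Q :* t)) :+ U :* V :* e :* (Q :* (Q :* t′))
            := U :* (Q :* (Q :* (e :* (t :+ t′))) :* V)) refl
          (u (2 ℕ.* n)) (v (n ℕ.∸ suc k) * v (n ℕ.+ suc k)) (sgn (suc k))
          (q ^ (suc k ℕ.* suc k)) (q ^ tri k) (q ^ tri (suc k)))

      symmetric-rogers-ramanujan : ∀ n →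
        Σ< (suc n) (fold± (summand n))
        ≈ binom (2 ℕ.* n) (+ n) * u n * Σ< (suc n) (λ k → binom n (+ k) * pow (+ k ℤ.* + k))
      symmetric-rogers-ramanujan n = begin
        Σ< (suc n) (fold± (summand n))
          ≈⟨ Σ<-cong (suc n) (λ { k (s≤s k≤n) → fold±-summand n k k≤n }) ⟩
        Σ< (suc n) (λ k → U * L k)
          ≈⟨ *-distribˡ-Σ< (suc n) U L ⟨
        U * Σ< (suc n) L
          ≈⟨ *-congˡ (finite-rogers-ramanujan n) ⟩
        U * Σ< (suc n) S
          -- Inserts (u n v n)² = 1. Both factors `v n` go with `U` to form the central coefficient,
          -- one `u n` is the factor (q;q)ₙ, and the other makes each `S k` a q-binomial coefficient
          -- times its power of q.
          ≈⟨ *-congˡ (trans (*-cong (trans (*-cong (u*v n) (u*v n)) (*-identityˡ 1#)) refl) (*-identityˡ _)) ⟨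
        U * (u n * v n * (u n * v n) * Σ< (suc n) S)
          ≈⟨ solve 4 (λ U x y s → U :* (x :* y :* (x :* y) :* s) := U :* (y :* y) :* x :* (x :* s))
               refl U (u n) (v n) (Σ< (suc n) S) ⟩
        U * (v n * v n) * u n * (u n * Σ< (suc n) S)
          ≈⟨ *-cong (*-congʳ central) (*-distribˡ-Σ< (suc n) (u n) S) ⟩
        binom (2 ℕ.* n) (+ n) * u n * Σ< (suc n) (λ k → u n * S k)
          ≈⟨ *-congˡ (Σ<-cong (suc n) term) ⟩
        binom (2 ℕ.* n) (+ n) * u n * Σ< (suc n) (λ k → binom n (+ k) * pow (+ k ℤ.* + k)) ∎
        where
        U = u (2 ℕ.* n)
        L S : ℕ → Carrier
        L k = q ^ (k ℕ.* k) * (q ^ (k ℕ.* k) * α k) * (v (n ℕ.∸ k) * v (n ℕ.+ k))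
        S k = q ^ (k ℕ.* k) * v (n ℕ.∸ k) * v k
        central : U * (v n * v n) ≈ binom (2 ℕ.* n) (+ n)
        central = sym (trans (binom-≤ (2 ℕ.* n) n (ℕ.m≤m+n n (n ℕ.+ 0)))
          (*-congˡ (*-congˡ (v-cong (≡.trans (ℕ.m+n∸m≡n n (n ℕ.+ 0)) (ℕ.+-identityʳ n))))))
        term : ∀ k → k ℕ.< suc n → u n * S k ≈ binom n (+ k) * pow (+ k ℤ.* + k)
        term k (s≤s k≤n) = sym (trans
          (*-cong (binom-≤ n k k≤n)
            (trans (reflexive (cong pow (≡.sym (ℤ.pos-* k k)))) (pow-pos (k ℕ.* k))))
          (solve 4 (λ u x y Q → u :* (x :* y) :* Q := u :* (Q :* y :* x)) refl
            (u n) (v k) (v (n ℕ.∸ k)) (q ^ (k ℕ.* k))))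

-- Specialisation to the complex numbers.

open import Defs

private module CR where
  open CommutativeRing ℂ-commutativeRing public
  open import Algebra.Properties.Monoid.Sum *-monoid public
    using () renaming (sum-init-last to product-init-last; sum-cong-≗ to product-cong-≗)

open FiniteSums ℂ-commutativeRing
open Inverses ℂ-commutativeRing
open import Relation.Binary.Reasoning.Setoid CR.setoid

-- The case split is needed because the negative of `+ n` computes only for n zero or a successor.
∑-symmetric : ∀ n f → ∑ (ℤ.- (+ n)) (+ n) f ≈ Σ< (suc n) (fold± f)
∑-symmetric zero    f = Σ<-fold± 0 f
∑-symmetric (suc n) f = CR.trans
  (Σ<-cong (suc (suc n ℕ.+ suc n)) (λ i _ → CR.reflexive (cong f (ℤ.-m+n≡n⊖m (suc n) i))))
  (Σ<-fold± (suc n) f)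

∑-from-0 : ∀ n f → ∑ (+ 0) (+ n) f ≈ Σ< (suc n) (λ k → f (+ k))
∑-from-0 n f = CR.reflexive (cong (λ m → Σ< (suc m) (λ k → f (+ k))) (ℕ.+-identityʳ n))

poch-suc : ∀ q n → poch q q (suc n) ≈ poch q q n * (1# - q ^ suc n)
poch-suc q n = CR.trans
  (CR.product-init-last {n} (λ j → 1# - q * q ^ toℕ j))
  (CR.reflexive (cong₂ _*_
    (CR.product-cong-≗ {n} (λ j → cong (λ m → 1# - q * q ^ m) (Fin.toℕ-inject₁ j)))
    (cong (λ m → 1# - q * q ^ m) (Fin.toℕ-fromℕ n))))

module _ (q : ℂ) (0<∣q∣ : 0ʳ <ʳ ∣ q ∣) (∣q∣<1 : ∣ q ∣ <ʳ 1ʳ) where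
  open QSeries q 0<∣q∣ ∣q∣<1

  -- Comparing unequal complex numbers definitionally unfolds them down to
  -- integer arithmetic, so the reciprocals and, under the with below, the goal
  -- are kept abstract.
  abstract
    1/poch : ℕ → ℂ
    1/poch n = poch q q n ⁻¹[ poch-#0 q ∣q∣<1 n ]

    poch-inverse : ∀ n → poch q q n * 1/poch n ≈ 1#
    poch-inverse n = ⁻¹-inverseʳ (poch q q n) (poch-#0 q ∣q∣<1 n)

  -- `qBinom` inverts the whole denominator at once; uniqueness of inverses separates it into the
  -- two fixed reciprocals.
  quotient : ∀ n k l w x → w ≡ poch q q l → poch q q k * w * x ≈ 1# →
    poch q q n * x ≈ poch q q n * (1/poch k * 1/poch l)
  quotient n k l w x w≡ h = CR.*-congˡ {poch q q n} {x} {1/poch k * 1/poch l}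
    (inverse-* (poch q q k) w (1/poch k) (1/poch l) x (poch-inverse k)
      (≡.subst (λ w → w * 1/poch l ≈ 1#) (≡.sym w≡) (poch-inverse l)) h)

  abstract
    IsBinom : ℕ → ℕ → ℂ → Set
    IsBinom n k z = z ≈ poch q q n * (1/poch k * 1/poch (n ℕ.∸ k))

    -- A separate w lets unification read the second factor off qBinom, whose
    -- local l is not syntactically n ∸ k.
    isBinom : ∀ n k w (w#0 : poch q q k * w #0) → w ≡ poch q q (n ℕ.∸ k) →
      IsBinom n k (poch q q n * (poch q q k * w) ⁻¹[ w#0 ])
    isBinom n k w w#0 w≡ = quotient n k (n ℕ.∸ k) w ((poch q q k * w) ⁻¹[ w#0 ]) w≡
      (⁻¹-inverseʳ (poch q q k * w) w#0)

    isBinom⇒≈ : ∀ n k z → IsBinom n k z → z ≈ poch q q n * (1/poch k * 1/poch (n ℕ.∸ k))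
    isBinom⇒≈ n k z h = h

  qBinom-isBinom : ∀ n k → k ℕ.≤ n → IsBinom n k (qBinom n (+ k))
  qBinom-isBinom n k k≤n with k ℕ.≤? n
  ... | no k≰n = contradiction k≤n k≰n
  ... | yes _  = isBinom n k _ _ ≡.refl

  qBinom-≤ : ∀ n k → k ℕ.≤ n → qBinom n (+ k) ≈ poch q q n * (1/poch k * 1/poch (n ℕ.∸ k))
  qBinom-≤ n k k≤n = isBinom⇒≈ n k (qBinom n (+ k)) (qBinom-isBinom n k k≤n)

corollary3p7 : (q : ℂ) (0<∣q∣ : 0ʳ <ʳ ∣ q ∣) (∣q∣<1 : ∣ q ∣ <ʳ 1ʳ) (n : ℕ) →
    let open QSeries q 0<∣q∣ ∣q∣<1 in
    ∑ (ℤ.- (+ n)) (+ n) (λ k →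
    qBinom (2 ℕ.* n) (+ n ℤ.+ k) * ([-1]^ k) * (q^ (((+ 5 ℤ.* k ℤ.- + 1) ℤ.* k) ℤ./ + 2)))
    ≈ qBinom (2 ℕ.* n) (+ n) * poch q q n *
    ∑ (+ 0) (+ n) (λ k → qBinom n k * (q^ (k ℤ.* k)))
corollary3p7 q 0<∣q∣ ∣q∣<1 n = begin
  ∑ (ℤ.- (+ n)) (+ n) F
    ≈⟨ ∑-symmetric n F ⟩
  Σ< (suc n) (fold± F)
    -- The empty product, and signs and powers of q at nonnegative integers, agree by computation;
    -- only the signs at negative integers need the inverse of -1.
    ≈⟨ BaileyPairs.symmetric-rogers-ramanujan ℂ-commutativeRing q
         (poch q q) (1/poch q 0<∣q∣ ∣q∣<1) CR.refl (poch-suc q) (poch-inverse q 0<∣q∣ ∣q∣<1)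
         qBinom (qBinom-≤ q 0<∣q∣ ∣q∣<1)
         [-1]^_ (λ _ → CR.refl)
         (λ k → -1-inverse-^ _ (⁻¹-inverseʳ (- 1#) -1#0) (suc k))
         q^_ (λ _ → CR.refl) n ⟩
  qBinom (2 ℕ.* n) (+ n) * poch q q n * Σ< (suc n) (λ k → G (+ k))
    ≈⟨ CR.*-congˡ {qBinom (2 ℕ.* n) (+ n) * poch q q n} {∑ (+ 0) (+ n) G} {Σ< (suc n) (λ k → G (+ k))} (∑-from-0 n G) ⟨
  qBinom (2 ℕ.* n) (+ n) * poch q q n * ∑ (+ 0) (+ n) G ∎
  where
  open QSeries q 0<∣q∣ ∣q∣<1
  F G : ℤ → ℂ
  F k = qBinom (2 ℕ.* n) (+ n ℤ.+ k) * ([-1]^ k) * (q^ (((+ 5 ℤ.* k ℤ.- + 1) ℤ.* k) ℤ./ + 2))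
  G k = qBinom n k * (q^ (k ℤ.* k))
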